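{- For all positive integers $k$ and $\ell$, \[ \sum_{b\ge0} J(b,k,\ell)x^b = [z_1^k\cdots z_\ell^k]\left( \frac{1}{1-z_1}\cdots\frac{1}{1-z_\ell}\, D_{z_1,z_2}D_{z_1,z_2,z_3}\cdots D_{z_1,\dots,z_\ell}\, \frac{1}{2-h_k(1,x,xz_1,\dots,xz_\ell)}\right). \]
   Context: A composition is a finite sequence of positive integers; its size is the sum of its parts (the empty sequence is the composition of $0$). Write $[n]=\{1,\dots,n\}$. A (multiplex juggling) card is a triple $(\alpha,\beta,f)$ where $\alpha=(\alpha_1,\dots,\alpha_s)$ and $\beta=(\beta_1,\dots,\beta_t)$ are compositions with $|\alpha|=|\beta|$, and $f:[s]\to\{0\}\cup[t]$ is strictly increasing such that for all $i\in[s]$, if $f(i)\neq0$ then $\alpha_i\le\beta_{f(i)}$; $\alpha$ is the arrival and $\beta$ the departure composition. The card has $|\alpha|$ balls and has capacity $k$ if every part of $\alpha$ and $\beta$ is at most $k$. An $\ell$-card sequence with $b$ balls and capacity $k$ is a sequence $(C_1,\dots,C_\ell)$ of cards with $b$ balls and capacity $k$ such that the departure composition of $C_i$ equals the arrival composition of $C_{i+1}$ for all $i\in[\ell-1]$; $J(b,k,\ell)$ is the number of these. The complete homogeneous symmetric polynomial is $h_n(x_1,\dots,x_m)=\sum_{i_1+\dots+i_m=n}x_1^{i_1}\cdots x_m^{i_m}$ (sum over nonnegative integers), with $h_0=1$. For indeterminates $z_1,\dots,z_m$, $D_{z_1,\dots,z_m}$ is the linear operator on formal power series in $z_m$ (whose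 coefficients may involve the other variables), acting termwise by $D_{z_1,\dots,z_m}z_m^n=h_n(1,z_1,\dots,z_{m-1})z_m^n$. $[z_1^k\cdots z_\ell^k]F$ denotes the coefficient of $z_1^k\cdots z_\ell^k$ in $F$ (a power series in $x$). -}

module Defs where

open import Data.Nat as ℕ using (ℕ; zero; suc; _≤_; _∸_; _≡ᵇ_)
open import Data.Integer as ℤ using (ℤ; +_; 0ℤ; 1ℤ)
open import Data.Fin as Fin using (Fin; toℕ)
open import Data.List as List using (List; []; _∷_; length; upTo; concatMap; filter)
open import Data.List.Relation.Unary.All using (All)
open import Data.Nat.ListAction using (sum)
open import Data.Vec as Vec using (Vec; []; _∷_; replicate; lookup; tabulate; allFin)
import Data.Vec.Properties as VecP
open import Data.Bool using (if_then_else_)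
open import Relation.Nullary using (does)
open import Relation.Binary.PropositionalEquality using (_≡_)

-- A card with b balls and capacity k.
-- Compositions are lists of positive integers; a composition α of length s
-- is indexed by Fin (length α) ≅ [s].  The map f : [s] → {0} ∪ [t] is a
-- vector of elements of Fin (suc t), where Fin.zero encodes 0 and
-- Fin.suc j encodes j+1 ∈ [t].  Proof fields are irrelevant, so two cards
-- are equal iff their data (α, β, f) are equal.
record Card (b k : ℕ) : Set where
  field
    arrival   : List ℕ
    departure : List ℕ
    f         : Vec (Fin (suc (length departure))) (length arrival)
    .arrival-pos   : All (λ p → 1 ≤ p) arrival
    .departure-pos : All (λ p → 1 ≤ p) departure
    .arrival-size   : sum arrival ≡ b
    .departure-size : sum departure ≡ b
    .arrival-cap   : All (λ p → p ≤ k) arrival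
    .departure-cap : All (λ p → p ≤ k) departure
    .f-incr : (i j : Fin (length arrival)) → i Fin.< j → lookup f i Fin.< lookup f j
    .f-fits : (i : Fin (length arrival)) (j : Fin (length departure)) →
              lookup f i ≡ Fin.suc j → List.lookup arrival i ≤ List.lookup departure j

open Card public

record CardSeq (b k ℓ : ℕ) : Set where
  field
    cards : Vec (Card b k) ℓ
    .chain : (i j : Fin ℓ) → toℕ j ≡ suc (toℕ i) →
             departure (lookup cards i) ≡ arrival (lookup cards j)

open CardSeq public

-- Formal power series in n variables with integer coefficients,
-- represented by their coefficient functions on exponent vectors.
-- For the theorem, n = ℓ+1, variable 0 is x and variable i (1≤i≤ℓ) is z_i.

Series : ℕ → Set
Series n = Vec ℕ n → ℤ

expAt : ∀ {n} → Vec ℕ n → ℕ → ℕ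
expAt []      _       = 0
expAt (x ∷ v) zero    = x
expAt (x ∷ v) (suc j) = expAt v j

unitN : (n : ℕ) → ℕ → Vec ℕ n
unitN zero    _       = []
unitN (suc n) zero    = 1 ∷ replicate n 0
unitN (suc n) (suc j) = 0 ∷ unitN n j

below : ∀ {n} → Vec ℕ n → List (Vec ℕ n)
below []      = [] ∷ []
below (m ∷ e) = concatMap (λ i → List.map (i ∷_) (below e)) (upTo (suc m))

sumℤ : List ℤ → ℤ
sumℤ = List.foldr ℤ._+_ 0ℤ

_≟v_ : ∀ {n} → (a b : Vec ℕ n) → _
_≟v_ = VecP.≡-dec ℕ._≟_

mono : ∀ {n} → Vec ℕ n → Series n
mono a e = if does (a ≟v e) then 1ℤ else 0ℤ

oneS : ∀ {n} → Series n
oneS {n} = mono (replicate n 0)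

constS : ∀ {n} → ℤ → Series n
constS c e = c ℤ.* oneS e

var : ∀ {n} → ℕ → Series n
var {n} j = mono (unitN n j)

_+S_ : ∀ {n} → Series n → Series n → Series n
(F +S G) e = F e ℤ.+ G e

_-S_ : ∀ {n} → Series n → Series n → Series n
(F -S G) e = F e ℤ.- G e

_*S_ : ∀ {n} → Series n → Series n → Series n
(F *S G) e = sumℤ (List.map (λ a → F a ℤ.* G (Vec.zipWith _∸_ e a)) (below e))

sumS : ∀ {n} → List (Series n) → Series n
sumS Fs e = sumℤ (List.map (λ F → F e) Fs)

prodS : ∀ {n r} → Vec (Series n) r → Series n
prodS = Vec.foldr _ _*S_ oneS

powS : ∀ {n} → Series n → ℕ → Series n
powS F zero    = oneS
powS F (suc m) = F *S powS F m

weakComps : (d r : ℕ) → List (Vec ℕ r)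
weakComps d r = filter (λ v → Vec.sum v ℕ.≟ d) (below (replicate r d))

hS : ∀ {n r} → ℕ → Vec (Series n) r → Series n
hS d Fs = sumS (List.map (λ is → prodS (Vec.zipWith powS Fs is)) (weakComps d _))

zvars : ∀ {n} → (j : ℕ) → Vec (Series n) j
zvars j = tabulate (λ i → var (suc (toℕ i)))

slice : ∀ {n} → ℕ → ℕ → Series n → Series n
slice m d F e = if expAt e m ≡ᵇ d then F e else 0ℤ

-- D_{z_1,…,z_m}:  F = Σ_d f_d z_m^d  ↦  Σ_d h_d(1,z_1,…,z_{m-1}) f_d z_m^d .
-- At exponent e only the terms with d ≤ e_m can contribute (every monomial
-- of the d-th term has z_m-degree d), so the sum is over d = 0,…,e_m.
Dop : ∀ {n} → ℕ → Series n → Series n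
Dop m F e =
  sumℤ (List.map (λ d → (hS d (oneS ∷ zvars (m ∸ 1)) *S slice m d F) e)
                 (upTo (suc (expAt e m))))

Dchain : ∀ {n} → ℕ → Series n → Series n
Dchain zero          F = F
Dchain (suc zero)    F = F
Dchain (suc (suc j)) F = Dchain (suc j) (Dop (suc (suc j)) F)

-- 1/(1 - z_i) = Σ_d z_i^d
geomS : ∀ {n} → ℕ → Series n
geomS {n} i e = if does (e ≟v Vec.map (expAt e i ℕ.*_) (unitN n i)) then 1ℤ else 0ℤ

Hk : (k ℓ : ℕ) → Series (suc ℓ)
Hk k ℓ = hS k (oneS ∷ var 0 ∷ Vec.map (λ i → var 0 *S var (suc (toℕ i))) (allFin ℓ))

IsInverseOf2-Hk : (k ℓ : ℕ) → Series (suc ℓ) → Set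
IsInverseOf2-Hk k ℓ G = ∀ e → (G *S (constS (+ 2) -S Hk k ℓ)) e ≡ oneS e

RHSseries : (ℓ : ℕ) → Series (suc ℓ) → Series (suc ℓ)
RHSseries ℓ G = prodS (Vec.map (λ i → geomS (suc (toℕ i))) (allFin ℓ)) *S Dchain ℓ G

RHScoeff : (k ℓ : ℕ) → Series (suc ℓ) → ℕ → ℤ
RHScoeff k ℓ G b = RHSseries ℓ G (b ∷ replicate ℓ k)

{-# OPTIONS --safe #-}
-- A card ending in a composition β amounts to a choice of γ ≤ β (partwise): the dropped group has
-- N = |β| - |γ| balls, the arrival composition is (N, γ) without its zero parts, and f enumerates
-- the support of (N, γ).  On the other side, ∏ h_{βᵢ}(1,z₁,…,z_{j+1}) is the sum over γ ≤ β of
-- z_{j+1}^N ∏ h_{γᵢ}(1,z₁,…,z_j), and D_{z₁,…,z_{j+1}} supplies the missing factor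
-- h_N(1,z₁,…,z_j), so that extracting the coefficient in z_{j+1} is one step of the same
-- recursion.  Finally 1/(2 - h_k(1,x,xz₁,…,xz_ℓ)) is the sum over all compositions β with parts
-- in [k] of x^{|β|} ∏ h_{βᵢ}(1,z₁,…,z_ℓ).  All operators on series are replaced by their adjoints
-- acting on test functions of the exponent.
module Submission where

open import Defs
open import Data.Nat as ℕ using (ℕ; zero; suc; _≤_; _<_; _∸_; z≤n; s≤s)
import Data.Nat.Properties as ℕₚ
open import Data.Nat.ListAction using (sum)
open import Data.Integer as ℤ using (ℤ; +_; 0ℤ; 1ℤ; -1ℤ; _+_; _*_)
import Data.Integer.Properties as ℤₚ
open import Data.Integer.Tactic.RingSolver using (solve-∀)
open import Data.Fin as Fin using (Fin; toℕ; inject₁; fromℕ)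
import Data.Fin.Properties as Finₚ
open import Data.Fin.Relation.Unary.Top using (view; ‵fromℕ; ‵inject₁)
open import Data.List as List using (List; []; _∷_; upTo; concatMap; filter; length; _++_)
import Data.List.Properties as Listₚ
open import Data.List.Membership.Propositional using (_∈_; find)
open import Data.List.Membership.Propositional.Properties using (∈-upTo⁻; ∈-map⁻; ∈-concatMap⁻; ∈-lookup)
open import Data.List.Relation.Unary.Any using (here; there)
open import Data.List.Relation.Unary.All as All using (All; []; _∷_)
open import Data.List.Relation.Binary.Pointwise using (Pointwise; []; _∷_)
open import Data.List.Relation.Binary.Pointwise.Properties using () renaming (irrelevant to Pointwise-irrelevant)
open import Data.Vec as Vec using (Vec; []; _∷_; _∷ʳ_; replicate; zipWith; lookup; tabulate; allFin; initLast)
import Data.Vec.Properties as Vecₚ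
open import Data.Bool using (true; false; if_then_else_; _∧_)
open import Data.Product using (Σ; ∃; _×_; _,_; proj₁; proj₂)
open import Data.Product.Properties.WithK using (,-injectiveʳ)
open import Data.Sum using (_⊎_; inj₁; inj₂)
open import Data.Sum.Function.Propositional using (_⊎-↔_)
open import Data.Unit using (⊤; tt)
open import Relation.Nullary using (Dec; yes; no; does; ¬_; contradiction; recompute)
open import Relation.Nullary.Decidable using (dec-true; dec-false; does-⇔)
open import Relation.Nullary.Irrelevant using (Irrelevant)
open import Relation.Unary using (Decidable)
open import Relation.Binary.PropositionalEquality hiding (J)
open import Function using (_∘_; id; const; mk⇔)
open import Function.Bundles using (_↔_; mk↔ₛ′)
open import Function.Properties.Inverse using (↔-trans)

open ≡-Reasoning

-- Finite sums

-- The factors `1/(1 - z_i)` encode the capacity: the power of `z_i` is the size `N` of the group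
-- dropped by the i-th card, and the coefficient of `z_i^k` after multiplication by `1/(1 - z_i)`
-- collects all powers with `N ≤ k`. Two obstacles shape the proof: each `D` multiplies a term by a
-- factor that depends on the degree of that term, and `G` is known only through the equation that
-- it satisfies. On the side of the test function both disappear. The coefficient at
-- `M = (b, k, …, k)` sees only the finite box below `M`, where a degree is a coordinate of the
-- exponent, and `G` is unfolded by its equation until the power of `x` exceeds `b`. Cards are
-- removed from the last one on, because `z_ℓ` is touched by `D_{z_1,…,z_ℓ}` alone, whereas `z_1`
-- enters every operator.

opaque
  ∑ : {A : Set} → List A → (A → ℤ) → ℤ
  ∑ L φ = sumℤ (List.map φ L)

  ∑-cong-∈ : {A : Set} (L : List A) {φ ψ : A → ℤ} → (∀ {a} → a ∈ L → φ a ≡ ψ a) → ∑ L φ ≡ ∑ L ψ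
  ∑-cong-∈ []      eq = refl
  ∑-cong-∈ (a ∷ L) eq = cong₂ _+_ (eq (here refl)) (∑-cong-∈ L (eq ∘ there))

  ∑-cong : {A : Set} (L : List A) {φ ψ : A → ℤ} → (∀ a → φ a ≡ ψ a) → ∑ L φ ≡ ∑ L ψ
  ∑-cong L eq = ∑-cong-∈ L (λ {a} _ → eq a)

  ∑-0 : {A : Set} (L : List A) → ∑ L (λ _ → 0ℤ) ≡ 0ℤ
  ∑-0 []      = refl
  ∑-0 (_ ∷ L) = trans (ℤₚ.+-identityˡ _) (∑-0 L)

  ∑-zero : {A : Set} (L : List A) {φ : A → ℤ} → (∀ a → φ a ≡ 0ℤ) → ∑ L φ ≡ 0ℤ
  ∑-zero L eq = trans (∑-cong L eq) (∑-0 L)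

  ∑-+ : {A : Set} (L : List A) (φ ψ : A → ℤ) → ∑ L (λ a → φ a + ψ a) ≡ ∑ L φ + ∑ L ψ
  ∑-+ []      φ ψ = refl
  ∑-+ (a ∷ L) φ ψ = trans (cong (_+_ (φ a + ψ a)) (∑-+ L φ ψ)) (interchange (φ a) (ψ a) (∑ L φ) (∑ L ψ))
    where
    interchange : ∀ a b c d → a + b + (c + d) ≡ a + c + (b + d)
    interchange = solve-∀

  ∑-*ˡ : {A : Set} (L : List A) (c : ℤ) (φ : A → ℤ) → c * ∑ L φ ≡ ∑ L (λ a → c * φ a)
  ∑-*ˡ []      c φ = ℤₚ.*-zeroʳ c
  ∑-*ˡ (a ∷ L) c φ = trans (ℤₚ.*-distribˡ-+ c _ _) (cong (_+_ (c * φ a)) (∑-*ˡ L c φ))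

  ∑-*ʳ : {A : Set} (L : List A) (c : ℤ) (φ : A → ℤ) → ∑ L φ * c ≡ ∑ L (λ a → φ a * c)
  ∑-*ʳ L c φ = trans (ℤₚ.*-comm _ c) (trans (∑-*ˡ L c φ) (∑-cong L (λ a → ℤₚ.*-comm c (φ a))))

  ∑-swap : {A B : Set} (L : List A) (M : List B) (φ : A → B → ℤ) →
           ∑ L (λ a → ∑ M (φ a)) ≡ ∑ M (λ b → ∑ L (λ a → φ a b))
  ∑-swap []      M φ = sym (∑-0 M)
  ∑-swap (a ∷ L) M φ = trans (cong (_+_ (∑ M (φ a))) (∑-swap L M φ)) (sym (∑-+ M _ _))

  ∑-map : {A B : Set} (f : A → B) (L : List A) (φ : B → ℤ) → ∑ (List.map f L) φ ≡ ∑ L (φ ∘ f)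
  ∑-map f L φ = cong sumℤ (sym (Listₚ.map-∘ L))

  ∑-++ : {A : Set} (L M : List A) (φ : A → ℤ) → ∑ (L ++ M) φ ≡ ∑ L φ + ∑ M φ
  ∑-++ []      M φ = sym (ℤₚ.+-identityˡ _)
  ∑-++ (a ∷ L) M φ = trans (cong (_+_ (φ a)) (∑-++ L M φ)) (sym (ℤₚ.+-assoc (φ a) _ _))

  ∑-concatMap : {A B : Set} (f : A → List B) (L : List A) (φ : B → ℤ) →
                ∑ (concatMap f L) φ ≡ ∑ L (λ a → ∑ (f a) φ)
  ∑-concatMap f []      φ = refl
  ∑-concatMap f (a ∷ L) φ = trans (∑-++ (f a) _ φ) (cong (_+_ (∑ (f a) φ)) (∑-concatMap f L φ))

  ∑-filter : {A : Set} {P : A → Set} (P? : Decidable P) (L : List A) (φ : A → ℤ) →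
             ∑ (filter P? L) φ ≡ ∑ L (λ a → if does (P? a) then φ a else 0ℤ)
  ∑-filter P? []      φ = refl
  ∑-filter P? (a ∷ L) φ with does (P? a)
  ... | true  = cong (_+_ (φ a)) (∑-filter P? L φ)
  ... | false = trans (∑-filter P? L φ) (sym (ℤₚ.+-identityˡ _))

  sumℤ-map : {A : Set} (L : List A) (φ : A → ℤ) → sumℤ (List.map φ L) ≡ ∑ L φ
  sumℤ-map L φ = refl

  ∑-suc : ∀ n (φ : ℕ → ℤ) → ∑ (upTo (suc n)) φ ≡ φ 0 + ∑ (upTo n) (φ ∘ suc)
  ∑-suc n φ = cong (_+_ (φ 0)) (trans (cong (λ L → ∑ L φ) (sym (Listₚ.map-upTo suc n))) (∑-map suc (upTo n) φ))

  ∑-∷ : {A : Set} (a : A) (L : List A) (φ : A → ℤ) → ∑ (a ∷ L) φ ≡ φ a + ∑ L φ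
  ∑-∷ a L φ = refl

  ∑-[] : {A : Set} (φ : A → ℤ) → ∑ [] φ ≡ 0ℤ
  ∑-[] φ = refl

∑-[-] : {A : Set} (a : A) (φ : A → ℤ) → ∑ (a ∷ []) φ ≡ φ a
∑-[-] a φ = trans (∑-∷ a [] φ) (trans (cong (_+_ (φ a)) (∑-[] φ)) (ℤₚ.+-identityʳ (φ a)))

∑-last : ∀ n (φ : ℕ → ℤ) → ∑ (upTo (suc n)) φ ≡ ∑ (upTo n) φ + φ n
∑-last n φ = begin
  ∑ (upTo (suc n)) φ        ≡⟨ cong (λ L → ∑ L φ) (sym (Listₚ.upTo-∷ʳ n)) ⟩
  ∑ (upTo n ++ n ∷ []) φ    ≡⟨ ∑-++ (upTo n) (n ∷ []) φ ⟩
  ∑ (upTo n) φ + ∑ (n ∷ []) φ ≡⟨ cong (_+_ (∑ (upTo n) φ)) (∑-[-] n φ) ⟩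
  ∑ (upTo n) φ + φ n        ∎

∑-upTo-cong : ∀ n {φ ψ : ℕ → ℤ} → (∀ {i} → i < n → φ i ≡ ψ i) → ∑ (upTo n) φ ≡ ∑ (upTo n) ψ
∑-upTo-cong n eq = ∑-cong-∈ (upTo n) (eq ∘ ∈-upTo⁻)

∑-reflect : ∀ n (φ : ℕ → ℤ) → ∑ (upTo (suc n)) φ ≡ ∑ (upTo (suc n)) (λ i → φ (n ∸ i))
∑-reflect zero    φ = trans (∑-[-] 0 φ) (sym (∑-[-] 0 _))
∑-reflect (suc n) φ = begin
  ∑ (upTo (suc (suc n))) φ                          ≡⟨ ∑-last (suc n) φ ⟩
  ∑ (upTo (suc n)) φ + φ (suc n)                    ≡⟨ ℤₚ.+-comm _ (φ (suc n)) ⟩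
  φ (suc n) + ∑ (upTo (suc n)) φ                    ≡⟨ cong (_+_ (φ (suc n))) (∑-reflect n φ) ⟩
  φ (suc n) + ∑ (upTo (suc n)) (λ i → φ (n ∸ i))    ≡⟨ sym (∑-suc (suc n) (λ i → φ (suc n ∸ i))) ⟩
  ∑ (upTo (suc (suc n))) (λ i → φ (suc n ∸ i))      ∎

∑-extend : ∀ n d (φ : ℕ → ℤ) → (∀ {i} → n ≤ i → φ i ≡ 0ℤ) → ∑ (upTo n) φ ≡ ∑ (upTo (n ℕ.+ d)) φ
∑-extend zero    d φ vanish = trans (∑-[] φ) (sym (∑-zero (upTo d) (λ _ → vanish z≤n)))
∑-extend (suc n) d φ vanish = begin
  ∑ (upTo (suc n)) φ                  ≡⟨ ∑-suc n φ ⟩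
  φ 0 + ∑ (upTo n) (φ ∘ suc)          ≡⟨ cong (_+_ (φ 0)) (∑-extend n d (φ ∘ suc) (vanish ∘ s≤s)) ⟩
  φ 0 + ∑ (upTo (n ℕ.+ d)) (φ ∘ suc)  ≡⟨ sym (∑-suc (n ℕ.+ d) φ) ⟩
  ∑ (upTo (suc n ℕ.+ d)) φ            ∎

∑-extend-≤ : ∀ {n m} (φ : ℕ → ℤ) → n ≤ m → (∀ {i} → n ≤ i → φ i ≡ 0ℤ) → ∑ (upTo n) φ ≡ ∑ (upTo m) φ
∑-extend-≤ {n} {m} φ n≤m vanish =
  trans (∑-extend n (m ∸ n) φ vanish) (cong (λ l → ∑ (upTo l) φ) (ℕₚ.m+[n∸m]≡n n≤m))

∑-single : ∀ {n i} (φ : ℕ → ℤ) → i < n → (∀ j → j ≢ i → φ j ≡ 0ℤ) → ∑ (upTo n) φ ≡ φ i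
∑-single {suc n} {zero} φ i<n vanish = begin
  ∑ (upTo (suc n)) φ         ≡⟨ ∑-suc n φ ⟩
  φ 0 + ∑ (upTo n) (φ ∘ suc) ≡⟨ cong (_+_ (φ 0)) (∑-zero (upTo n) (λ j → vanish (suc j) (λ ()))) ⟩
  φ 0 + 0ℤ                   ≡⟨ ℤₚ.+-identityʳ (φ 0) ⟩
  φ 0                        ∎
∑-single {suc n} {suc i} φ (s≤s i<n) vanish = begin
  ∑ (upTo (suc n)) φ         ≡⟨ ∑-suc n φ ⟩
  φ 0 + ∑ (upTo n) (φ ∘ suc) ≡⟨ cong₂ _+_ (vanish 0 (λ ())) (∑-single (φ ∘ suc) i<n (λ j j≢i → vanish (suc j) (j≢i ∘ ℕₚ.suc-injective))) ⟩
  0ℤ + φ (suc i)             ≡⟨ ℤₚ.+-identityˡ _ ⟩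
  φ (suc i)                  ∎

-- Peeling off the row `a = 0` takes one point from each antidiagonal and leaves a triangle one size
-- smaller.
∑-antidiagonals : ∀ m (φ : ℕ → ℕ → ℤ) →
  ∑ (upTo (suc m)) (λ e → ∑ (upTo (suc e)) (λ a → φ a (e ∸ a))) ≡
  ∑ (upTo (suc m)) (λ a → ∑ (upTo (suc (m ∸ a))) (φ a))
∑-antidiagonals zero    φ = trans (∑-[-] 0 _) (trans (∑-[-] 0 _) (sym (trans (∑-[-] 0 _) (∑-[-] 0 _))))
∑-antidiagonals (suc m) φ = begin
  ∑ (upTo (suc (suc m))) (λ e → ∑ (upTo (suc e)) (λ a → φ a (e ∸ a)))
    ≡⟨ ∑-suc (suc m) _ ⟩
  ∑ (upTo 1) (λ a → φ a (0 ∸ a)) + ∑ (upTo (suc m)) (λ e → ∑ (upTo (suc (suc e))) (λ a → φ a (suc e ∸ a)))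
    ≡⟨ cong₂ _+_ (∑-[-] 0 _) (∑-cong (upTo (suc m)) (λ e → ∑-suc (suc e) _)) ⟩
  φ 0 0 + ∑ (upTo (suc m)) (λ e → φ 0 (suc e) + ∑ (upTo (suc e)) (λ a → φ (suc a) (e ∸ a)))
    ≡⟨ cong (_+_ (φ 0 0)) (∑-+ (upTo (suc m)) _ _) ⟩
  φ 0 0 + (∑ (upTo (suc m)) (φ 0 ∘ suc) + ∑ (upTo (suc m)) (λ e → ∑ (upTo (suc e)) (λ a → φ (suc a) (e ∸ a))))
    ≡⟨ sym (ℤₚ.+-assoc (φ 0 0) _ _) ⟩
  φ 0 0 + ∑ (upTo (suc m)) (φ 0 ∘ suc) + ∑ (upTo (suc m)) (λ e → ∑ (upTo (suc e)) (λ a → φ (suc a) (e ∸ a)))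
    ≡⟨ cong₂ _+_ (sym (∑-suc (suc m) (φ 0))) (∑-antidiagonals m (φ ∘ suc)) ⟩
  ∑ (upTo (suc (suc m))) (φ 0) + ∑ (upTo (suc m)) (λ a → ∑ (upTo (suc (m ∸ a))) (φ (suc a)))
    ≡⟨ sym (∑-suc (suc m) (λ a → ∑ (upTo (suc (suc m ∸ a))) (φ a))) ⟩
  ∑ (upTo (suc (suc m))) (λ a → ∑ (upTo (suc (suc m ∸ a))) (φ a)) ∎

-- Reflecting each antidiagonal exchanges the two coordinates, so both orders reduce to
-- `∑-antidiagonals`.
∑-triangle-swap : ∀ m (φ : ℕ → ℕ → ℤ) →
  ∑ (upTo (suc m)) (λ a → ∑ (upTo (suc (m ∸ a))) (φ a)) ≡
  ∑ (upTo (suc m)) (λ c → ∑ (upTo (suc (m ∸ c))) (λ a → φ a c))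
∑-triangle-swap m φ = begin
  ∑ (upTo (suc m)) (λ a → ∑ (upTo (suc (m ∸ a))) (φ a))
    ≡⟨ sym (∑-antidiagonals m φ) ⟩
  ∑ (upTo (suc m)) (λ e → ∑ (upTo (suc e)) (λ a → φ a (e ∸ a)))
    ≡⟨ ∑-cong (upTo (suc m)) (λ e → trans (∑-reflect e _)
         (∑-upTo-cong (suc e) (λ { {c} (s≤s c≤e) → cong (φ (e ∸ c)) (ℕₚ.m∸[m∸n]≡n c≤e) }))) ⟩
  ∑ (upTo (suc m)) (λ e → ∑ (upTo (suc e)) (λ c → φ (e ∸ c) c))
    ≡⟨ ∑-antidiagonals m (λ c a → φ a c) ⟩
  ∑ (upTo (suc m)) (λ c → ∑ (upTo (suc (m ∸ c))) (λ a → φ a c)) ∎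

-- Exponents

infixl 6 _⊕_
infixr 7 _⊙_

_⊕_ : ∀ {n} → Vec ℕ n → Vec ℕ n → Vec ℕ n
_⊕_ = zipWith ℕ._+_

_⊙_ : ∀ {n} → ℕ → Vec ℕ n → Vec ℕ n
q ⊙ u = Vec.map (q ℕ.*_) u

𝟘 : ∀ {n} → Vec ℕ n
𝟘 = replicate _ 0

⊕-comm : ∀ {n} (a c : Vec ℕ n) → a ⊕ c ≡ c ⊕ a
⊕-comm = Vecₚ.zipWith-comm ℕₚ.+-comm

⊕-assoc : ∀ {n} (a c d : Vec ℕ n) → (a ⊕ c) ⊕ d ≡ a ⊕ (c ⊕ d)
⊕-assoc = Vecₚ.zipWith-assoc ℕₚ.+-assoc

⊕-identityʳ : ∀ {n} (a : Vec ℕ n) → a ⊕ 𝟘 ≡ a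
⊕-identityʳ = Vecₚ.zipWith-identityʳ ℕₚ.+-identityʳ

⊕-swapʳ : ∀ {n} (a c d : Vec ℕ n) → (a ⊕ c) ⊕ d ≡ (a ⊕ d) ⊕ c
⊕-swapʳ a c d = trans (⊕-assoc a c d) (trans (cong (a ⊕_) (⊕-comm c d)) (sym (⊕-assoc a d c)))

0⊙ : ∀ {n} (u : Vec ℕ n) → 0 ⊙ u ≡ 𝟘
0⊙ u = Vecₚ.map-const u 0

⊙-𝟘 : ∀ {n} q → q ⊙ 𝟘 {n} ≡ 𝟘
⊙-𝟘 {n} q = trans (Vecₚ.map-replicate (q ℕ.*_) 0 n) (cong (replicate n) (ℕₚ.*-zeroʳ q))

⊙-distribʳ : ∀ {n} p q (u : Vec ℕ n) → (p ℕ.+ q) ⊙ u ≡ p ⊙ u ⊕ q ⊙ u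
⊙-distribʳ p q []      = refl
⊙-distribʳ p q (x ∷ u) = cong₂ _∷_ (ℕₚ.*-distribʳ-+ x p q) (⊙-distribʳ p q u)

⊙-distribˡ : ∀ {n} q (u v : Vec ℕ n) → q ⊙ (u ⊕ v) ≡ q ⊙ u ⊕ q ⊙ v
⊙-distribˡ q []      []      = refl
⊙-distribˡ q (x ∷ u) (y ∷ v) = cong₂ _∷_ (ℕₚ.*-distribˡ-+ q x y) (⊙-distribˡ q u v)

1⊙ : ∀ {n} (u : Vec ℕ n) → 1 ⊙ u ≡ u
1⊙ u = trans (Vecₚ.map-cong ℕₚ.*-identityˡ u) (Vecₚ.map-id u)

expAt-⊕ : ∀ {n} (a c : Vec ℕ n) j → expAt (a ⊕ c) j ≡ expAt a j ℕ.+ expAt c j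
expAt-⊕ []      []      j       = refl
expAt-⊕ (x ∷ a) (y ∷ c) zero    = refl
expAt-⊕ (x ∷ a) (y ∷ c) (suc j) = expAt-⊕ a c j

expAt-∸ : ∀ {n} (a c : Vec ℕ n) j → expAt (zipWith _∸_ a c) j ≡ expAt a j ∸ expAt c j
expAt-∸ []      []      j       = refl
expAt-∸ (x ∷ a) (y ∷ c) zero    = refl
expAt-∸ (x ∷ a) (y ∷ c) (suc j) = expAt-∸ a c j

expAt-⊙ : ∀ {n} q (u : Vec ℕ n) j → expAt (q ⊙ u) j ≡ q ℕ.* expAt u j
expAt-⊙ q []      j       = sym (ℕₚ.*-zeroʳ q)
expAt-⊙ q (x ∷ u) zero    = refl
expAt-⊙ q (x ∷ u) (suc j) = expAt-⊙ q u j

expAt-replicate : ∀ n x j → j < n → expAt (replicate n x) j ≡ x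
expAt-replicate (suc n) x zero    _         = refl
expAt-replicate (suc n) x (suc j) (s≤s j<n) = expAt-replicate n x j j<n

expAt-𝟘 : ∀ n j → expAt (𝟘 {n}) j ≡ 0
expAt-𝟘 zero    j       = refl
expAt-𝟘 (suc n) zero    = refl
expAt-𝟘 (suc n) (suc j) = expAt-𝟘 n j

expAt-ext : ∀ {n} {a c : Vec ℕ n} → (∀ j → expAt a j ≡ expAt c j) → a ≡ c
expAt-ext {a = []}    {[]}    eq = refl
expAt-ext {a = x ∷ a} {y ∷ c} eq = cong₂ _∷_ (eq 0) (expAt-ext (eq ∘ suc))

expAt-unit : ∀ n j → j < n → expAt (unitN n j) j ≡ 1
expAt-unit (suc n) zero    _         = refl
expAt-unit (suc n) (suc j) (s≤s j<n) = expAt-unit n j j<n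

expAt-unit-≢ : ∀ n i j → i ≢ j → expAt (unitN n i) j ≡ 0
expAt-unit-≢ zero    i       j       i≢j = refl
expAt-unit-≢ (suc n) zero    zero    i≢j = contradiction refl i≢j
expAt-unit-≢ (suc n) zero    (suc j) i≢j = expAt-𝟘 n j
expAt-unit-≢ (suc n) (suc i) zero    i≢j = refl
expAt-unit-≢ (suc n) (suc i) (suc j) i≢j = expAt-unit-≢ n i j (i≢j ∘ cong suc)

-- Sums over boxes of exponents

∑-below-∷ : ∀ {n} x (m : Vec ℕ n) (φ : Vec ℕ (suc n) → ℤ) →
            ∑ (below (x ∷ m)) φ ≡ ∑ (upTo (suc x)) (λ i → ∑ (below m) (λ a → φ (i ∷ a)))
∑-below-∷ x m φ = trans (∑-concatMap _ (upTo (suc x)) φ) (∑-cong (upTo (suc x)) (λ i → ∑-map (i ∷_) (below m) φ))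

below-≤ : ∀ {n} (m : Vec ℕ n) {a} → a ∈ below m → ∀ j → expAt a j ≤ expAt m j
below-≤ []      (here refl) j = z≤n
below-≤ (x ∷ m) a∈ j with find (∈-concatMap⁻ (λ i → List.map (i ∷_) (below m)) {xs = upTo (suc x)} a∈)
... | i , i∈ , a∈′ with ∈-map⁻ (i ∷_) a∈′
below-≤ (x ∷ m) a∈ zero    | i , i∈ , a∈′ | a , a∈″ , refl = ℕₚ.≤-pred (∈-upTo⁻ i∈)
below-≤ (x ∷ m) a∈ (suc j) | i , i∈ , a∈′ | a , a∈″ , refl = below-≤ m a∈″ j

⊕-∸-cancel : ∀ {n} (e : Vec ℕ n) {a} → a ∈ below e → a ⊕ zipWith _∸_ e a ≡ e
⊕-∸-cancel e {a} a∈ = expAt-ext λ j →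
  trans (expAt-⊕ a _ j) (trans (cong (expAt a j ℕ.+_) (expAt-∸ e a j)) (ℕₚ.m+[n∸m]≡n (below-≤ e a∈ j)))

record Supp {n} (m : Vec ℕ n) (g : Vec ℕ n → ℤ) : Set where
  constructor supported
  field vanishes : ∀ e j → expAt m j < expAt e j → g e ≡ 0ℤ

open Supp public

Supp-⊕ : ∀ {n} {m : Vec ℕ n} {g} → Supp m g → ∀ u → Supp m (λ e → g (e ⊕ u))
Supp-⊕ supp u .vanishes e j m<e = supp .vanishes (e ⊕ u) j
  (ℕₚ.<-≤-trans m<e (subst (expAt e j ≤_) (sym (expAt-⊕ e u j)) (ℕₚ.m≤m+n _ _)))

Supp-⊕ˡ : ∀ {n} {m : Vec ℕ n} {g} → Supp m g → ∀ u → Supp m (λ e → g (u ⊕ e))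
Supp-⊕ˡ {g = g} supp u .vanishes e j m<e = trans (cong g (⊕-comm u e)) (Supp-⊕ supp u .vanishes e j m<e)

-- The support hypothesis pads the region `a + c ≤ m` to a full square, so that a Cauchy product
-- tested on a box becomes a double sum with independent indices.
∑-below-antidiagonals : ∀ {n} (m : Vec ℕ n) (φ : Vec ℕ n → Vec ℕ n → ℤ) →
  (∀ a c j → expAt m j < expAt (a ⊕ c) j → φ a c ≡ 0ℤ) →
  ∑ (below m) (λ e → ∑ (below e) (λ a → φ a (zipWith _∸_ e a))) ≡
  ∑ (below m) (λ a → ∑ (below m) (φ a))
∑-below-antidiagonals []      φ supp = trans (∑-[-] [] _) (trans (∑-[-] [] _) (sym (trans (∑-[-] [] _) (∑-[-] [] _))))
∑-below-antidiagonals (x ∷ m) φ supp = begin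
  ∑ (below (x ∷ m)) (λ e → ∑ (below e) (λ a → φ a (zipWith _∸_ e a)))
    ≡⟨ ∑-below-∷ x m _ ⟩
  ∑ X (λ i → ∑ (below m) (λ e → ∑ (below (i ∷ e)) (λ a → φ a (zipWith _∸_ (i ∷ e) a))))
    ≡⟨ ∑-cong X (λ i → ∑-cong (below m) (λ e → ∑-below-∷ i e _)) ⟩
  ∑ X (λ i → ∑ (below m) (λ e → ∑ (upTo (suc i)) (λ a₀ → ∑ (below e) (λ a → φ (a₀ ∷ a) (i ∸ a₀ ∷ zipWith _∸_ e a)))))
    ≡⟨ ∑-cong X (λ i → ∑-swap (below m) (upTo (suc i)) _) ⟩
  ∑ X (λ i → ∑ (upTo (suc i)) (λ a₀ → ∑ (below m) (λ e → ∑ (below e) (λ a → φ (a₀ ∷ a) (i ∸ a₀ ∷ zipWith _∸_ e a)))))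
    ≡⟨ ∑-cong X (λ i → ∑-cong (upTo (suc i)) (λ a₀ →
         ∑-below-antidiagonals m (λ a c → φ (a₀ ∷ a) (i ∸ a₀ ∷ c)) (λ a c j → supp _ _ (suc j)))) ⟩
  ∑ X (λ i → ∑ (upTo (suc i)) (λ a₀ → Ψ a₀ (i ∸ a₀)))
    ≡⟨ ∑-antidiagonals x Ψ ⟩
  ∑ X (λ a₀ → ∑ (upTo (suc (x ∸ a₀))) (Ψ a₀))
    ≡⟨ ∑-cong X (λ a₀ → ∑-extend-≤ (Ψ a₀) (s≤s (ℕₚ.m∸n≤m x a₀)) (λ {c₀} → Ψ-supp a₀ c₀)) ⟩
  ∑ X (λ a₀ → ∑ X (λ c₀ → ∑ (below m) (λ a → ∑ (below m) (λ c → φ (a₀ ∷ a) (c₀ ∷ c)))))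
    ≡⟨ ∑-cong X (λ a₀ → ∑-swap X (below m) _) ⟩
  ∑ X (λ a₀ → ∑ (below m) (λ a → ∑ X (λ c₀ → ∑ (below m) (λ c → φ (a₀ ∷ a) (c₀ ∷ c)))))
    ≡⟨ ∑-cong X (λ a₀ → ∑-cong (below m) (λ a → sym (∑-below-∷ x m _))) ⟩
  ∑ X (λ a₀ → ∑ (below m) (λ a → ∑ (below (x ∷ m)) (φ (a₀ ∷ a))))
    ≡⟨ sym (∑-below-∷ x m _) ⟩
  ∑ (below (x ∷ m)) (λ a → ∑ (below (x ∷ m)) (φ a)) ∎
  where
  X : List ℕ
  X = upTo (suc x)
  Ψ : ℕ → ℕ → ℤ
  Ψ a₀ c₀ = ∑ (below m) (λ a → ∑ (below m) (λ c → φ (a₀ ∷ a) (c₀ ∷ c)))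
  Ψ-supp : ∀ a₀ c₀ → suc (x ∸ a₀) ≤ c₀ → Ψ a₀ c₀ ≡ 0ℤ
  Ψ-supp a₀ c₀ lt = ∑-zero (below m) (λ a → ∑-zero (below m) (λ c →
    supp (a₀ ∷ a) (c₀ ∷ c) 0 (ℕₚ.<-≤-trans (s≤s (ℕₚ.m≤n+m∸n x a₀))
      (ℕₚ.≤-trans (ℕₚ.≤-reflexive (sym (ℕₚ.+-suc a₀ _))) (ℕₚ.+-monoʳ-≤ a₀ lt)))))

-- A series is studied through its pairing with test functions supported in a box.

pair : ∀ {n} → Vec ℕ n → Series n → (Vec ℕ n → ℤ) → ℤ
pair m F g = ∑ (below m) (λ e → F e * g e)

pair-cong : ∀ {n} (m : Vec ℕ n) F {g h : Vec ℕ n → ℤ} → (∀ e → g e ≡ h e) → pair m F g ≡ pair m F h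
pair-cong m F eq = ∑-cong (below m) (λ e → cong (F e *_) (eq e))

pair-congˡ : ∀ {n} (m : Vec ℕ n) {F G : Series n} g → (∀ e → F e ≡ G e) → pair m F g ≡ pair m G g
pair-congˡ m g eq = ∑-cong (below m) (λ e → cong (_* g e) (eq e))

pair-* : ∀ {n} (m : Vec ℕ n) (P F : Series n) g → Supp m g →
         pair m (P *S F) g ≡ ∑ (below m) (λ a → ∑ (below m) (λ c → P a * (F c * g (a ⊕ c))))
pair-* m P F g supp = begin
  ∑ (below m) (λ e → (P *S F) e * g e)
    ≡⟨ ∑-cong (below m) (λ e → trans (cong (_* g e) (sumℤ-map (below e) _)) (∑-*ʳ (below e) (g e) _)) ⟩
  ∑ (below m) (λ e → ∑ (below e) (λ a → P a * F (zipWith _∸_ e a) * g e))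
    ≡⟨ ∑-cong (below m) (λ e → ∑-cong-∈ (below e) (λ {a} a∈ →
         trans (ℤₚ.*-assoc (P a) _ _) (cong (λ e′ → P a * (F (zipWith _∸_ e a) * g e′)) (sym (⊕-∸-cancel e a∈))))) ⟩
  ∑ (below m) (λ e → ∑ (below e) (λ a → P a * (F (zipWith _∸_ e a) * g (a ⊕ zipWith _∸_ e a))))
    ≡⟨ ∑-below-antidiagonals m (λ a c → P a * (F c * g (a ⊕ c))) (λ a c j lt →
         trans (cong (λ z → P a * (F c * z)) (supp .vanishes (a ⊕ c) j lt))
           (trans (cong (P a *_) (ℤₚ.*-zeroʳ (F c))) (ℤₚ.*-zeroʳ (P a)))) ⟩
  ∑ (below m) (λ a → ∑ (below m) (λ c → P a * (F c * g (a ⊕ c)))) ∎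

pair-*ˡ : ∀ {n} (m : Vec ℕ n) (P F : Series n) g → Supp m g →
          pair m (P *S F) g ≡ pair m P (λ a → pair m F (λ c → g (a ⊕ c)))
pair-*ˡ m P F g supp = trans (pair-* m P F g supp) (∑-cong (below m) (λ a → sym (∑-*ˡ (below m) (P a) _)))

-- The inner pairing is the adjoint of multiplication by `P` applied to `g`, while `F` remains the
-- series under test.
pair-*ʳ : ∀ {n} (m : Vec ℕ n) (P F : Series n) g → Supp m g →
          pair m (P *S F) g ≡ pair m F (λ c → pair m P (λ a → g (c ⊕ a)))
pair-*ʳ m P F g supp = begin
  pair m (P *S F) g ≡⟨ pair-* m P F g supp ⟩
  ∑ (below m) (λ a → ∑ (below m) (λ c → P a * (F c * g (a ⊕ c))))
    ≡⟨ ∑-swap (below m) (below m) _ ⟩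
  ∑ (below m) (λ c → ∑ (below m) (λ a → P a * (F c * g (a ⊕ c))))
    ≡⟨ ∑-cong (below m) (λ c → trans
         (∑-cong (below m) (λ a → trans (exchange (P a) (F c) _) (cong (λ e → F c * (P a * g e)) (⊕-comm a c))))
         (sym (∑-*ˡ (below m) (F c) _))) ⟩
  pair m F (λ c → pair m P (λ a → g (c ⊕ a))) ∎
  where
  exchange : ∀ x y z → x * (y * z) ≡ y * (x * z)
  exchange = solve-∀

-- Monomials as evaluation functionals

mono-∷-≡ : ∀ {n} x (u a : Vec ℕ n) → mono (x ∷ u) (x ∷ a) ≡ mono u a
mono-∷-≡ x u a = cong (λ t → if t ∧ does (u ≟v a) then 1ℤ else 0ℤ) (dec-true (x ℕ.≟ x) refl)

mono-≢ : ∀ {n} (u a : Vec ℕ n) → u ≢ a → mono u a ≡ 0ℤ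
mono-≢ u a u≢a = cong (λ t → if t then 1ℤ else 0ℤ) (dec-false (u ≟v a) u≢a)

mono-refl : ∀ {n} (u : Vec ℕ n) → mono u u ≡ 1ℤ
mono-refl u = cong (λ t → if t then 1ℤ else 0ℤ) (dec-true (u ≟v u) refl)

-- Being the monomial with exponent `u` is stated only as far as test functions can see it; the
-- property then passes to products and powers without any computation of coefficients. A box that
-- misses `u` is harmless, since a supported `g` is zero at `u`.
record Represents {n} (F : Series n) (u : Vec ℕ n) : Set where
  field pair-≡ : ∀ m g → Supp m g → pair m F g ≡ g u

open Represents public

mono-represents : ∀ {n} (u : Vec ℕ n) → Represents (mono u) u
mono-represents []      .pair-≡ []      g supp = trans (∑-[-] [] _) (ℤₚ.*-identityˡ (g []))
mono-represents (y ∷ u) .pair-≡ (x ∷ m) g supp = trans (∑-below-∷ x m _) lemma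
  where
  row : ℕ → ℤ
  row i = ∑ (below m) (λ a → mono (y ∷ u) (i ∷ a) * g (i ∷ a))
  row-≢ : ∀ i → i ≢ y → row i ≡ 0ℤ
  row-≢ i i≢y = ∑-zero (below m) (λ a → trans (cong (_* g (i ∷ a)) (mono-≢ (y ∷ u) (i ∷ a) (i≢y ∘ sym ∘ Vecₚ.∷-injectiveˡ))) (ℤₚ.*-zeroˡ (g (i ∷ a))))
  row-≡ : row y ≡ g (y ∷ u)
  row-≡ = trans (∑-cong (below m) (λ a → cong (_* g (y ∷ a)) (mono-∷-≡ y u a)))
                (mono-represents u .pair-≡ m (g ∘ (y ∷_)) (supported λ e j → supp .vanishes (y ∷ e) (suc j)))
  lemma : ∑ (upTo (suc x)) row ≡ g (y ∷ u)
  lemma with y ℕ.≤? x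
  ... | yes y≤x = trans (∑-single row (s≤s y≤x) row-≢) row-≡
  ... | no  y≰x = trans (trans (∑-upTo-cong (suc x) (λ {i} i<sx → row-≢ i (λ { refl → y≰x (ℕₚ.≤-pred i<sx) }))) (∑-0 (upTo (suc x))))
                    (sym (supp .vanishes (y ∷ u) 0 (ℕₚ.≰⇒> y≰x)))

*-represents : ∀ {n} {F Q : Series n} {u v} → Represents F u → Represents Q v → Represents (F *S Q) (u ⊕ v)
*-represents {F = F} {Q} {u} {v} rF rQ .pair-≡ m g supp = begin
  pair m (F *S Q) g                         ≡⟨ pair-*ˡ m F Q g supp ⟩
  pair m F (λ a → pair m Q (λ c → g (a ⊕ c))) ≡⟨ pair-cong m F (λ a → rQ .pair-≡ m _ (Supp-⊕ˡ supp a)) ⟩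
  pair m F (λ a → g (a ⊕ v))                ≡⟨ rF .pair-≡ m _ (Supp-⊕ supp v) ⟩
  g (u ⊕ v)                                 ∎

powS-represents : ∀ {n} {F : Series n} {u} → Represents F u → ∀ q → Represents (powS F q) (q ⊙ u)
powS-represents {u = u} rF zero    = subst (Represents oneS) (sym (0⊙ u)) (mono-represents 𝟘)
powS-represents {u = u} rF (suc q) =
  subst (Represents _) (sym (trans (⊙-distribʳ 1 q u) (cong (_⊕ q ⊙ u) (1⊙ u)))) (*-represents rF (powS-represents rF q))

dot : ∀ {n r} → Vec (Vec ℕ n) r → Vec ℕ r → Vec ℕ n
dot []       []       = 𝟘
dot (u ∷ us) (q ∷ is) = q ⊙ u ⊕ dot us is

AllRepresent : ∀ {n r} → Vec (Series n) r → Vec (Vec ℕ n) r → Set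
AllRepresent Fs us = ∀ i → Represents (lookup Fs i) (lookup us i)

prodS-represents : ∀ {n r} (Fs : Vec (Series n) r) us → AllRepresent Fs us → ∀ is →
                   Represents (prodS (zipWith powS Fs is)) (dot us is)
prodS-represents []       []       rFs []       = mono-represents 𝟘
prodS-represents (F ∷ Fs) (u ∷ us) rFs (q ∷ is) =
  *-represents (powS-represents (rFs Fin.zero) q) (prodS-represents Fs us (rFs ∘ Fin.suc) is)

-- H us p g e = Σ g (e + i₁ u₁ + … + iᵣ uᵣ) over i₁ + … + iᵣ = p: the adjoint of
-- multiplication by h_p of the monomials with exponents us.
H : ∀ {n r} → Vec (Vec ℕ n) r → ℕ → (Vec ℕ n → ℤ) → Vec ℕ n → ℤ
H []       zero    g e = g e
H []       (suc _) g e = 0ℤ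
H (u ∷ us) p       g e = ∑ (upTo (suc p)) (λ q → H us (p ∸ q) g (e ⊕ q ⊙ u))

-- The side `D` of the box is kept apart from the degree `d`: the recursion lowers `d` with each
-- coordinate, while the box keeps its side.
∑-weakComps : ∀ {n r} (us : Vec (Vec ℕ n) r) D d g e → d ≤ D →
  ∑ (below (replicate r D)) (λ is → if does (Vec.sum is ℕ.≟ d) then g (e ⊕ dot us is) else 0ℤ) ≡ H us d g e
∑-weakComps []       D zero    g e d≤D = trans (∑-[-] [] _) (cong g (⊕-identityʳ e))
∑-weakComps []       D (suc d) g e d≤D = ∑-[-] [] _
∑-weakComps {r = suc r} (u ∷ us) D d g e d≤D = begin
  ∑ (below (replicate (suc r) D)) (λ is → if does (Vec.sum is ℕ.≟ d) then g (e ⊕ dot (u ∷ us) is) else 0ℤ)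
    ≡⟨ ∑-below-∷ D (replicate r D) _ ⟩
  ∑ (upTo (suc D)) row
    ≡⟨ sym (∑-extend-≤ row (s≤s d≤D) (λ {q} d<q → ∑-zero (below (replicate r D)) (λ is →
         cong (λ t → if t then g (e ⊕ dot (u ∷ us) (q ∷ is)) else 0ℤ)
           (dec-false (q ℕ.+ Vec.sum is ℕ.≟ d) (λ eq → ℕₚ.<⇒≢ (ℕₚ.<-≤-trans d<q (ℕₚ.m≤m+n q _)) (sym eq)))))) ⟩
  ∑ (upTo (suc d)) row
    ≡⟨ ∑-upTo-cong (suc d) (λ {q} q≤d → trans
         (∑-cong (below (replicate r D)) (λ is → cong₂ (λ t v → if t then g v else 0ℤ) (shift q (ℕₚ.≤-pred q≤d) is) (sym (⊕-assoc e (q ⊙ u) _))))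
         (∑-weakComps us D (d ∸ q) g (e ⊕ q ⊙ u) (ℕₚ.≤-trans (ℕₚ.m∸n≤m d q) d≤D))) ⟩
  ∑ (upTo (suc d)) (λ q → H us (d ∸ q) g (e ⊕ q ⊙ u)) ∎
  where
  row : ℕ → ℤ
  row q = ∑ (below (replicate r D)) (λ is → if does (q ℕ.+ Vec.sum is ℕ.≟ d) then g (e ⊕ dot (u ∷ us) (q ∷ is)) else 0ℤ)
  shift : ∀ q → q ≤ d → (is : Vec ℕ r) → does (q ℕ.+ Vec.sum is ℕ.≟ d) ≡ does (Vec.sum is ℕ.≟ d ∸ q)
  shift q q≤d is = does-⇔ (mk⇔ (λ eq → trans (sym (ℕₚ.m+n∸m≡n q (Vec.sum is))) (cong (_∸ q) eq))
                                (λ eq → trans (cong (q ℕ.+_) eq) (ℕₚ.m+[n∸m]≡n q≤d))) (q ℕ.+ Vec.sum is ℕ.≟ d) (Vec.sum is ℕ.≟ d ∸ q)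

pair-hS : ∀ {n r} (m : Vec ℕ n) d (Fs : Vec (Series n) r) us → AllRepresent Fs us →
          ∀ g e → Supp m g → pair m (hS d Fs) (λ a → g (e ⊕ a)) ≡ H us d g e
pair-hS {r = r} m d Fs us rFs g e supp = begin
  ∑ (below m) (λ a → hS d Fs a * g (e ⊕ a))
    ≡⟨ ∑-cong (below m) (λ a → trans (cong (_* g (e ⊕ a)) (trans (sumℤ-map (List.map P W) _) (∑-map P W _))) (∑-*ʳ W _ _)) ⟩
  ∑ (below m) (λ a → ∑ W (λ is → P is a * g (e ⊕ a)))
    ≡⟨ ∑-swap (below m) W _ ⟩
  ∑ W (λ is → pair m (P is) (λ a → g (e ⊕ a)))
    ≡⟨ ∑-cong W (λ is → prodS-represents Fs us rFs is .pair-≡ m _ (Supp-⊕ˡ supp e)) ⟩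
  ∑ W (λ is → g (e ⊕ dot us is))
    ≡⟨ ∑-filter (λ v → Vec.sum v ℕ.≟ d) (below (replicate r d)) _ ⟩
  ∑ (below (replicate r d)) (λ is → if does (Vec.sum is ℕ.≟ d) then g (e ⊕ dot us is) else 0ℤ)
    ≡⟨ ∑-weakComps us d d g e ℕₚ.≤-refl ⟩
  H us d g e ∎
  where
  W : List (Vec ℕ r)
  W = weakComps d r
  P : Vec ℕ r → Series _
  P is = prodS (zipWith powS Fs is)

pair-hS-* : ∀ {n r} (m : Vec ℕ n) d (Fs : Vec (Series n) r) us → AllRepresent Fs us →
            ∀ F g → Supp m g → pair m (hS d Fs *S F) g ≡ pair m F (H us d g)
pair-hS-* m d Fs us rFs F g supp = trans (pair-*ʳ m (hS d Fs) F g supp) (pair-cong m F (λ e → pair-hS m d Fs us rFs g e supp))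

-- The adjoint of the operators D

slice-≡ : ∀ {n} m (F : Series n) e → slice m (expAt e m) F e ≡ F e
slice-≡ m F e = cong (λ t → if t then F e else 0ℤ) (dec-true (expAt e m ℕ.≟ expAt e m) refl)

slice-≢ : ∀ {n} m d (F : Series n) e → expAt e m ≢ d → slice m d F e ≡ 0ℤ
slice-≢ m d F e ≢d = cong (λ t → if t then F e else 0ℤ) (dec-false (expAt e m ℕ.≟ d) ≢d)

-- At an exponent `e` only the slice `d = expAt e m` of `F` can be nonzero, so the adjoint is an `H`
-- whose degree is read off from `e` itself.
pair-Dop : ∀ {n} (M : Vec ℕ n) m (us : Vec (Vec ℕ n) (suc (m ∸ 1))) → AllRepresent (oneS ∷ zvars (m ∸ 1)) us →
           ∀ F g → Supp M g → pair M (Dop m F) g ≡ pair M F (λ e → H us (expAt e m) g e)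
pair-Dop M m us rus F g supp = begin
  ∑ (below M) (λ e → Dop m F e * g e)
    -- The range of `d` depends on `e`. Terms with `d > e_m` vanish, so it extends to a common
    -- range, after which the two sums can be exchanged.
    ≡⟨ ∑-cong-∈ (below M) (λ {e} e∈ → trans (cong (_* g e) (trans (sumℤ-map (upTo (suc (expAt e m))) _)
         (∑-extend-≤ _ (s≤s (below-≤ M e∈ m)) (λ {d} → beyond e d)))) (∑-*ʳ D (g e) _)) ⟩
  ∑ (below M) (λ e → ∑ D (λ d → (h d *S slice m d F) e * g e))
    ≡⟨ ∑-swap (below M) D _ ⟩
  ∑ D (λ d → pair M (h d *S slice m d F) g)
    ≡⟨ ∑-cong D (λ d → pair-hS-* M d (oneS ∷ zvars (m ∸ 1)) us rus (slice m d F) g supp) ⟩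
  ∑ D (λ d → ∑ (below M) (λ e → slice m d F e * H us d g e))
    ≡⟨ ∑-swap D (below M) _ ⟩
  ∑ (below M) (λ e → ∑ D (λ d → slice m d F e * H us d g e))
    ≡⟨ ∑-cong-∈ (below M) (λ {e} e∈ → trans
         (∑-single _ (s≤s (below-≤ M e∈ m)) (λ d d≢ → trans (cong (_* H us d g e) (slice-≢ m d F e (d≢ ∘ sym))) (ℤₚ.*-zeroˡ (H us d g e))))
         (cong (_* H us (expAt e m) g e) (slice-≡ m F e))) ⟩
  pair M F (λ e → H us (expAt e m) g e) ∎
  where
  D : List ℕ
  D = upTo (suc (expAt M m))
  h : ℕ → Series _
  h d = hS d (oneS ∷ zvars (m ∸ 1))
  beyond : ∀ e d → suc (expAt e m) ≤ d → (h d *S slice m d F) e ≡ 0ℤ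
  beyond e d e<d = trans (sumℤ-map (below e) _) (∑-zero (below e) (λ a →
    trans (cong (h d a *_) (slice-≢ m d F (zipWith _∸_ e a) (λ eq → ℕₚ.<⇒≱ e<d
      (ℕₚ.≤-trans (ℕₚ.≤-reflexive (trans (sym eq) (expAt-∸ e a m))) (ℕₚ.m∸n≤m (expAt e m) (expAt a m))))))
      (ℤₚ.*-zeroʳ (h d a))))

-- Complete homogeneous polynomials acting on test functions

Closed : ∀ {n r} → Vec (Vec ℕ n) r → (Vec ℕ n → Set) → Set
Closed us Q = ∀ i q {e} → Q e → Q (e ⊕ q ⊙ lookup us i)

-- `H us` evaluates its argument only at points reached from `e` by adding multiples of the `us`, so
-- agreement on a set closed under these moves is enough. This later freezes the coordinate that
-- determines the degree of a `D`.
H-cong-on : ∀ {n r} (us : Vec (Vec ℕ n) r) p {g h} (Q : Vec ℕ n → Set) → Closed us Q →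
            (∀ e → Q e → g e ≡ h e) → ∀ e → Q e → H us p g e ≡ H us p h e
H-cong-on []       zero    Q closed eq e Qe = eq e Qe
H-cong-on []       (suc p) Q closed eq e Qe = refl
H-cong-on (u ∷ us) p       Q closed eq e Qe = ∑-cong (upTo (suc p)) (λ q →
  H-cong-on us (p ∸ q) Q (closed ∘ Fin.suc) eq (e ⊕ q ⊙ u) (closed Fin.zero q Qe))

H-∑ : ∀ {n r} {A : Set} (us : Vec (Vec ℕ n) r) p (L : List A) (g : A → Vec ℕ n → ℤ) e →
      H us p (λ e → ∑ L (λ l → g l e)) e ≡ ∑ L (λ l → H us p (g l) e)
H-∑ []       zero    L g e = refl
H-∑ []       (suc p) L g e = sym (∑-0 L)
H-∑ (u ∷ us) p       L g e = trans (∑-cong (upTo (suc p)) (λ q → H-∑ us (p ∸ q) L g (e ⊕ q ⊙ u))) (∑-swap (upTo (suc p)) L _)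

H-0 : ∀ {n r} (us : Vec (Vec ℕ n) r) p e → H us p (const 0ℤ) e ≡ 0ℤ
H-0 []       zero    e = refl
H-0 []       (suc p) e = refl
H-0 (u ∷ us) p       e = ∑-zero (upTo (suc p)) (λ q → H-0 us (p ∸ q) _)

H-shift : ∀ {n r} (us : Vec (Vec ℕ n) r) p g u e → H us p (λ e → g (e ⊕ u)) e ≡ H us p g (e ⊕ u)
H-shift []       zero    g u e = refl
H-shift []       (suc p) g u e = refl
H-shift (v ∷ us) p       g u e = ∑-cong (upTo (suc p)) (λ q →
  trans (H-shift us (p ∸ q) g u (e ⊕ q ⊙ v)) (cong (H us (p ∸ q) g) (⊕-swapʳ e (q ⊙ v) u)))

⊕-0⊙ : ∀ {n} (e u : Vec ℕ n) → e ⊕ 0 ⊙ u ≡ e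
⊕-0⊙ e u = trans (cong (e ⊕_) (0⊙ u)) (⊕-identityʳ e)

⊕-⊙𝟘 : ∀ {n} (e : Vec ℕ n) q → e ⊕ q ⊙ 𝟘 ≡ e
⊕-⊙𝟘 e q = trans (cong (e ⊕_) (⊙-𝟘 q)) (⊕-identityʳ e)

H-degree0 : ∀ {n r} (us : Vec (Vec ℕ n) r) g e → H us 0 g e ≡ g e
H-degree0 []       g e = refl
H-degree0 (u ∷ us) g e = trans (∑-[-] 0 _) (trans (H-degree0 us g _) (cong g (⊕-0⊙ e u)))

-- `H` recurses from the front, but the variables of consecutive operators `D` are appended at the
-- end; exchanging the first and the last multiplicity is a swap of sums over a triangle.
H-∷ʳ : ∀ {n r} (us : Vec (Vec ℕ n) r) u p g e →
       H (us ∷ʳ u) p g e ≡ ∑ (upTo (suc p)) (λ q → H us (p ∸ q) g (e ⊕ q ⊙ u))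
H-∷ʳ []       u p g e = refl
H-∷ʳ (v ∷ us) u p g e = begin
  ∑ P (λ q → H (us ∷ʳ u) (p ∸ q) g (e ⊕ q ⊙ v))
    ≡⟨ ∑-cong P (λ q → H-∷ʳ us u (p ∸ q) g (e ⊕ q ⊙ v)) ⟩
  ∑ P (λ q → ∑ (upTo (suc (p ∸ q))) (λ r → H us (p ∸ q ∸ r) g (e ⊕ q ⊙ v ⊕ r ⊙ u)))
    ≡⟨ ∑-triangle-swap p (λ q r → H us (p ∸ q ∸ r) g (e ⊕ q ⊙ v ⊕ r ⊙ u)) ⟩
  ∑ P (λ r → ∑ (upTo (suc (p ∸ r))) (λ q → H us (p ∸ q ∸ r) g (e ⊕ q ⊙ v ⊕ r ⊙ u)))
    ≡⟨ ∑-cong P (λ r → ∑-cong (upTo (suc (p ∸ r))) (λ q →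
         cong₂ (λ s e → H us s g e) (∸-swapʳ q r) (⊕-swapʳ e (q ⊙ v) (r ⊙ u)))) ⟩
  ∑ P (λ r → ∑ (upTo (suc (p ∸ r))) (λ q → H us (p ∸ r ∸ q) g (e ⊕ r ⊙ u ⊕ q ⊙ v))) ∎
  where
  P : List ℕ
  P = upTo (suc p)
  ∸-swapʳ : ∀ q r → p ∸ q ∸ r ≡ p ∸ r ∸ q
  ∸-swapʳ q r = trans (ℕₚ.∸-+-assoc p q r) (trans (cong (p ∸_) (ℕₚ.+-comm q r)) (sym (ℕₚ.∸-+-assoc p r q)))

H-∷ʳ-reflected : ∀ {n r} (us : Vec (Vec ℕ n) r) u p g e →
                 H (us ∷ʳ u) p g e ≡ ∑ (upTo (suc p)) (λ r → H us r g (e ⊕ (p ∸ r) ⊙ u))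
H-∷ʳ-reflected us u p g e = trans (H-∷ʳ us u p g e) (trans (∑-reflect p _)
  (∑-upTo-cong (suc p) (λ { {r} (s≤s r≤p) → cong (λ s → H us s g (e ⊕ (p ∸ r) ⊙ u)) (ℕₚ.m∸[m∸n]≡n r≤p) })))

-- Homogeneity: `h_p(u v_1, u v_2, …) = u^p h_p(v_1, v_2, …)`.
H-pull : ∀ {n r} (u : Vec ℕ n) (us : Vec (Vec ℕ n) r) p g e →
         H (Vec.map (u ⊕_) us) p g e ≡ H us p g (e ⊕ p ⊙ u)
H-pull u []       zero    g e = cong g (sym (⊕-0⊙ e u))
H-pull u []       (suc p) g e = refl
H-pull u (v ∷ us) p       g e = ∑-upTo-cong (suc p) (λ { {q} (s≤s q≤p) →
  trans (H-pull u us (p ∸ q) g (e ⊕ q ⊙ (u ⊕ v))) (cong (H us (p ∸ q) g) (regroup q q≤p)) })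
  where
  regroup : ∀ q → q ≤ p → e ⊕ q ⊙ (u ⊕ v) ⊕ (p ∸ q) ⊙ u ≡ e ⊕ p ⊙ u ⊕ q ⊙ v
  regroup q q≤p = begin
    e ⊕ q ⊙ (u ⊕ v) ⊕ (p ∸ q) ⊙ u       ≡⟨ cong (λ w → e ⊕ w ⊕ (p ∸ q) ⊙ u) (⊙-distribˡ q u v) ⟩
    e ⊕ (q ⊙ u ⊕ q ⊙ v) ⊕ (p ∸ q) ⊙ u   ≡⟨ cong (_⊕ (p ∸ q) ⊙ u) (sym (⊕-assoc e (q ⊙ u) (q ⊙ v))) ⟩
    e ⊕ q ⊙ u ⊕ q ⊙ v ⊕ (p ∸ q) ⊙ u     ≡⟨ ⊕-swapʳ (e ⊕ q ⊙ u) (q ⊙ v) ((p ∸ q) ⊙ u) ⟩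
    e ⊕ q ⊙ u ⊕ (p ∸ q) ⊙ u ⊕ q ⊙ v     ≡⟨ cong (_⊕ q ⊙ v) (⊕-assoc e (q ⊙ u) ((p ∸ q) ⊙ u)) ⟩
    e ⊕ (q ⊙ u ⊕ (p ∸ q) ⊙ u) ⊕ q ⊙ v   ≡⟨ cong (λ w → e ⊕ w ⊕ q ⊙ v) (sym (⊙-distribʳ q (p ∸ q) u)) ⟩
    e ⊕ (q ℕ.+ (p ∸ q)) ⊙ u ⊕ q ⊙ v     ≡⟨ cong (λ s → e ⊕ s ⊙ u ⊕ q ⊙ v) (ℕₚ.m+[n∸m]≡n q≤p) ⟩
    e ⊕ p ⊙ u ⊕ q ⊙ v                   ∎

Closed-> : ∀ {n r} (us : Vec (Vec ℕ n) r) c j → Closed us (λ e → c < expAt e j)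
Closed-> us c j i q {e} c<e = ℕₚ.<-≤-trans c<e (subst (expAt e j ≤_) (sym (expAt-⊕ e _ j)) (ℕₚ.m≤m+n _ _))

H-vanish-on : ∀ {n r} (us : Vec (Vec ℕ n) r) p {g} (Q : Vec ℕ n → Set) → Closed us Q →
              (∀ e → Q e → g e ≡ 0ℤ) → ∀ e → Q e → H us p g e ≡ 0ℤ
H-vanish-on us p Q closed eq e Qe = trans (H-cong-on us p Q closed eq e Qe) (H-0 us p e)

H-Supp : ∀ {n r} (us : Vec (Vec ℕ n) r) p {m : Vec ℕ n} {g} → Supp m g → Supp m (H us p g)
H-Supp us p {m} supp .vanishes e j = H-vanish-on us p (λ e → expAt m j < expAt e j) (Closed-> us _ j) (λ e → supp .vanishes e j) e

-- The adjoint of multiplication by h_{β₁} h_{β₂} ⋯ of the monomials us.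
B : ∀ {n r} → Vec (Vec ℕ n) r → List ℕ → (Vec ℕ n → ℤ) → Vec ℕ n → ℤ
B us []      g = g
B us (p ∷ β) g = B us β (H us p g)

B-cong-on : ∀ {n r} (us : Vec (Vec ℕ n) r) β {g h} (Q : Vec ℕ n → Set) → Closed us Q →
            (∀ e → Q e → g e ≡ h e) → ∀ e → Q e → B us β g e ≡ B us β h e
B-cong-on us []      Q closed eq e Qe = eq e Qe
B-cong-on us (p ∷ β) Q closed eq e Qe = B-cong-on us β Q closed (H-cong-on us p Q closed eq) e Qe

B-cong : ∀ {n r} (us : Vec (Vec ℕ n) r) β {g h} → (∀ e → g e ≡ h e) → ∀ e → B us β g e ≡ B us β h e
B-cong us β eq e = B-cong-on us β (const ⊤) _ (λ e _ → eq e) e _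

B-0 : ∀ {n r} (us : Vec (Vec ℕ n) r) β e → B us β (const 0ℤ) e ≡ 0ℤ
B-0 us []      e = refl
B-0 us (p ∷ β) e = trans (B-cong us β (H-0 us p) e) (B-0 us β e)

B-vanish-on : ∀ {n r} (us : Vec (Vec ℕ n) r) β {g} (Q : Vec ℕ n → Set) → Closed us Q →
              (∀ e → Q e → g e ≡ 0ℤ) → ∀ e → Q e → B us β g e ≡ 0ℤ
B-vanish-on us β Q closed eq e Qe = trans (B-cong-on us β Q closed eq e Qe) (B-0 us β e)

B-∑ : ∀ {n r} {A : Set} (us : Vec (Vec ℕ n) r) β (L : List A) (g : A → Vec ℕ n → ℤ) e →
      B us β (λ e → ∑ L (λ l → g l e)) e ≡ ∑ L (λ l → B us β (g l) e)
B-∑ us []      L g e = refl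
B-∑ us (p ∷ β) L g e = trans (B-cong us β (H-∑ us p L g) e) (B-∑ us β L (λ l → H us p (g l)) e)

B-shift : ∀ {n r} (us : Vec (Vec ℕ n) r) β g u e → B us β (λ e → g (e ⊕ u)) e ≡ B us β g (e ⊕ u)
B-shift us []      g u e = refl
B-shift us (p ∷ β) g u e = trans (B-cong us β (H-shift us p g u) e) (B-shift us β (H us p g) u e)

strip : List ℕ → List ℕ
strip []          = []
strip (zero ∷ γ)  = strip γ
strip (suc a ∷ γ) = suc a ∷ strip γ

-- A zero part contributes the factor `h_0 = 1`.
B-strip : ∀ {n r} (us : Vec (Vec ℕ n) r) γ g e → B us (strip γ) g e ≡ B us γ g e
B-strip us []          g e = refl
B-strip us (zero ∷ γ)  g e = trans (B-strip us γ g e) (B-cong us γ (λ e → sym (H-degree0 us g e)) e)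
B-strip us (suc a ∷ γ) g e = B-strip us γ (H us (suc a) g) e

-- The tail is summed outermost, as in `B`, where the tail acts on the result of the first part. A
-- zero in `γ` stands for a part of `β` made up of dropped balls only.
∑≤ : List ℕ → (List ℕ → ℤ) → ℤ
∑≤ []      φ = φ []
∑≤ (p ∷ β) φ = ∑≤ β (λ γ → ∑ (upTo (suc p)) (λ r → φ (r ∷ γ)))

∑≤-cong : ∀ β {φ ψ} → (∀ {γ} → Pointwise _≤_ γ β → φ γ ≡ ψ γ) → ∑≤ β φ ≡ ∑≤ β ψ
∑≤-cong []      eq = eq []
∑≤-cong (p ∷ β) eq = ∑≤-cong β (λ γ≤β → ∑-upTo-cong (suc p) (λ r<p → eq (ℕₚ.≤-pred r<p ∷ γ≤β)))

sum-mono : ∀ {γ β} → Pointwise _≤_ γ β → sum γ ≤ sum β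
sum-mono []          = z≤n
sum-mono (r≤p ∷ γ≤β) = ℕₚ.+-mono-≤ r≤p (sum-mono γ≤β)

+-∸-interchange : ∀ {p r s t} → r ≤ p → t ≤ s → (s ∸ t) ℕ.+ (p ∸ r) ≡ (p ℕ.+ s) ∸ (r ℕ.+ t)
+-∸-interchange {p} {r} {s} {t} r≤p t≤s = begin
  (s ∸ t) ℕ.+ (p ∸ r)   ≡⟨ ℕₚ.+-comm (s ∸ t) (p ∸ r) ⟩
  (p ∸ r) ℕ.+ (s ∸ t)   ≡⟨ sym (ℕₚ.+-∸-assoc (p ∸ r) t≤s) ⟩
  (p ∸ r) ℕ.+ s ∸ t     ≡⟨ cong (_∸ t) (sym (ℕₚ.+-∸-comm s r≤p)) ⟩
  p ℕ.+ s ∸ r ∸ t       ≡⟨ ℕₚ.∸-+-assoc (p ℕ.+ s) r t ⟩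
  p ℕ.+ s ∸ (r ℕ.+ t)   ∎

-- ∏ h_{β_i}(us, u) is the sum over γ ≤ β of u^{|β|-|γ|} ∏ h_{γ_i}(us).
B-∷ʳ : ∀ {n r} (us : Vec (Vec ℕ n) r) u β g e →
       B (us ∷ʳ u) β g e ≡ ∑≤ β (λ γ → B us γ g (e ⊕ (sum β ∸ sum γ) ⊙ u))
B-∷ʳ us u []      g e = cong g (sym (⊕-0⊙ e u))
B-∷ʳ us u (p ∷ β) g e = trans (B-∷ʳ us u β (H (us ∷ʳ u) p g) e) (∑≤-cong β (λ {γ} γ≤β → split γ γ≤β))
  where
  split : ∀ γ → Pointwise _≤_ γ β →
          B us γ (H (us ∷ʳ u) p g) (e ⊕ (sum β ∸ sum γ) ⊙ u) ≡
          ∑ (upTo (suc p)) (λ r → B us γ (H us r g) (e ⊕ (p ℕ.+ sum β ∸ (r ℕ.+ sum γ)) ⊙ u))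
  split γ γ≤β = begin
    B us γ (H (us ∷ʳ u) p g) e′
      ≡⟨ B-cong us γ (H-∷ʳ-reflected us u p g) e′ ⟩
    B us γ (λ e → ∑ (upTo (suc p)) (λ r → H us r g (e ⊕ (p ∸ r) ⊙ u))) e′
      ≡⟨ B-∑ us γ (upTo (suc p)) _ e′ ⟩
    ∑ (upTo (suc p)) (λ r → B us γ (λ e → H us r g (e ⊕ (p ∸ r) ⊙ u)) e′)
      ≡⟨ ∑-upTo-cong (suc p) (λ { {r} (s≤s r≤p) → trans (B-shift us γ (H us r g) ((p ∸ r) ⊙ u) e′)
           (cong (B us γ (H us r g)) (merge r r≤p)) }) ⟩
    ∑ (upTo (suc p)) (λ r → B us γ (H us r g) (e ⊕ (p ℕ.+ sum β ∸ (r ℕ.+ sum γ)) ⊙ u)) ∎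
    where
    N : ℕ
    N = sum β ∸ sum γ
    e′ : Vec ℕ _
    e′ = e ⊕ N ⊙ u
    merge : ∀ r → r ≤ p → e′ ⊕ (p ∸ r) ⊙ u ≡ e ⊕ (p ℕ.+ sum β ∸ (r ℕ.+ sum γ)) ⊙ u
    merge r r≤p = trans (⊕-assoc e _ _) (cong (e ⊕_) (trans (sym (⊙-distribʳ N (p ∸ r) u))
      (cong (_⊙ u) (+-∸-interchange r≤p (sum-mono γ≤β)))))

-- The right-hand side

-- Only the term `q = p` survives, which is `h_p(1) = 1`; hence `D_{z_1}` is the identity.
H-𝟘 : ∀ {n} p g (e : Vec ℕ n) → H (𝟘 ∷ []) p g e ≡ g e
H-𝟘 p g e = begin
  ∑ (upTo (suc p)) (λ q → H [] (p ∸ q) g (e ⊕ q ⊙ 𝟘)) ≡⟨ ∑-cong (upTo (suc p)) (λ q → cong (H [] (p ∸ q) g) (⊕-⊙𝟘 e q)) ⟩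
  ∑ (upTo (suc p)) (λ q → H [] (p ∸ q) g e)           ≡⟨ ∑-reflect p _ ⟩
  ∑ (upTo (suc p)) (λ i → H [] (p ∸ (p ∸ i)) g e)
    ≡⟨ ∑-upTo-cong (suc p) (λ { {i} (s≤s i≤p) → cong (λ r → H [] r g e) (ℕₚ.m∸[m∸n]≡n i≤p) }) ⟩
  ∑ (upTo (suc p)) (λ i → H [] i g e)
    ≡⟨ ∑-single _ (s≤s z≤n) (λ { zero ≢0 → contradiction refl ≢0 ; (suc _) _ → refl }) ⟩
  g e ∎

expAt-≥ : ∀ {n} (e : Vec ℕ n) j → n ≤ j → expAt e j ≡ 0
expAt-≥ []      j       _         = refl
expAt-≥ (x ∷ e) (suc j) (s≤s n≤j) = expAt-≥ e j n≤j

Supp-pair : ∀ {n} {m : Vec ℕ n} {ψ} → Supp m ψ → ∀ P → Supp m (λ a → pair m P (λ c → ψ (a ⊕ c)))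
Supp-pair {m = m} supp P .vanishes a j m<a =
  ∑-zero (below m) (λ c → trans (cong (P c *_) (Supp-⊕ supp c .vanishes a j m<a)) (ℤₚ.*-zeroʳ (P c)))

Supp-mono : ∀ {n} (m : Vec ℕ n) → Supp m (mono m)
Supp-mono m .vanishes e j m<e = mono-≢ m e (λ { refl → ℕₚ.<-irrefl refl m<e })

-- `mono m` is idempotent: one copy serves as the series, the other keeps the test function inside
-- the box.
pair-mono : ∀ {n} (m : Vec ℕ n) F → pair m F (mono m) ≡ F m
pair-mono m F = begin
  ∑ (below m) (λ e → F e * mono m e)               ≡⟨ ∑-cong (below m) idem ⟩
  ∑ (below m) (λ e → mono m e * (F e * mono m e))  ≡⟨ mono-represents m .pair-≡ m _ supp ⟩
  F m * mono m m                                   ≡⟨ cong (F m *_) (mono-refl m) ⟩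
  F m * 1ℤ                                         ≡⟨ ℤₚ.*-identityʳ (F m) ⟩
  F m                                              ∎
  where
  supp : Supp m (λ e → F e * mono m e)
  supp .vanishes e j m<e = trans (cong (F e *_) (Supp-mono m .vanishes e j m<e)) (ℤₚ.*-zeroʳ (F e))
  idem : ∀ e → F e * mono m e ≡ mono m e * (F e * mono m e)
  idem e with m ≟v e
  ... | yes _ = sym (ℤₚ.*-identityˡ (F e * 1ℤ))
  ... | no  _ = ℤₚ.*-zeroʳ (F e)

-- The factors 1/(1 - z_i)

expAt-⊙unit : ∀ n d i → i < n → expAt (d ⊙ unitN n i) i ≡ d
expAt-⊙unit n d i i<n = trans (expAt-⊙ d (unitN n i) i) (trans (cong (d ℕ.*_) (expAt-unit n i i<n)) (ℕₚ.*-identityʳ d))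

expAt-⊙unit-≢ : ∀ n d {i j} → i ≢ j → expAt (d ⊙ unitN n i) j ≡ 0
expAt-⊙unit-≢ n d {i} {j} i≢j = trans (expAt-⊙ d (unitN n i) j) (trans (cong (d ℕ.*_) (expAt-unit-≢ n i j i≢j)) (ℕₚ.*-zeroʳ d))

expAt-⊕unit : ∀ {n} (e : Vec ℕ n) d i → i < n → expAt (e ⊕ d ⊙ unitN n i) i ≡ expAt e i ℕ.+ d
expAt-⊕unit e d i i<n = trans (expAt-⊕ e _ i) (cong (expAt e i ℕ.+_) (expAt-⊙unit _ d i i<n))

expAt-⊕unit-≢ : ∀ {n} (e : Vec ℕ n) d {i j} → i ≢ j → expAt (e ⊕ d ⊙ unitN n i) j ≡ expAt e j
expAt-⊕unit-≢ {n} e d {i} {j} i≢j = trans (expAt-⊕ e _ j) (trans (cong (expAt e j ℕ.+_) (expAt-⊙unit-≢ n d {i} i≢j)) (ℕₚ.+-identityʳ _))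

pair-geomS : ∀ {n} (m : Vec ℕ n) i → i < n → ∀ ψ → Supp m ψ →
             pair m (geomS i) ψ ≡ ∑ (upTo (suc (expAt m i))) (λ d → ψ (d ⊙ unitN n i))
pair-geomS {n} m i i<n ψ supp = begin
  ∑ (below m) (λ a → geomS i a * ψ a)
    ≡⟨ ∑-cong-∈ (below m) (λ {a} a∈ → trans (cong (_* ψ a) (expand a (below-≤ m a∈ i))) (∑-*ʳ D (ψ a) _)) ⟩
  ∑ (below m) (λ a → ∑ D (λ d → mono (d ⊙ unitN n i) a * ψ a))
    ≡⟨ ∑-swap (below m) D _ ⟩
  ∑ D (λ d → pair m (mono (d ⊙ unitN n i)) ψ)
    ≡⟨ ∑-cong D (λ d → mono-represents (d ⊙ unitN n i) .pair-≡ m ψ supp) ⟩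
  ∑ D (λ d → ψ (d ⊙ unitN n i)) ∎
  where
  D : List ℕ
  D = upTo (suc (expAt m i))
  expand : ∀ a → expAt a i ≤ expAt m i → geomS i a ≡ ∑ D (λ d → mono (d ⊙ unitN n i) a)
  expand a a≤m = sym (trans
    (∑-single _ (s≤s a≤m) (λ d d≢ → mono-≢ (d ⊙ unitN n i) a (λ eq → d≢ (trans (sym (expAt-⊙unit n d i i<n)) (cong (λ e → expAt e i) eq)))))
    (cong (λ t → if t then 1ℤ else 0ℤ) (does-⇔ (mk⇔ sym sym) ((expAt a i ⊙ unitN n i) ≟v a) (a ≟v (expAt a i ⊙ unitN n i)))))

range : ∀ r → ℕ → Vec ℕ r
range zero    s = []
range (suc r) s = s ∷ range r (suc s)

tabulate-range : ∀ {A : Set} r (F : ℕ → A) s → tabulate {n = r} (λ i → F (s ℕ.+ toℕ i)) ≡ Vec.map F (range r s)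
tabulate-range zero    F s = refl
tabulate-range (suc r) F s = cong₂ _∷_ (cong F (ℕₚ.+-identityʳ s))
  (trans (Vecₚ.tabulate-cong (λ i → cong F (ℕₚ.+-suc s (toℕ i)))) (tabulate-range r F (suc s)))

∑geom : ∀ {n r} → Vec ℕ n → Vec ℕ r → (Vec ℕ n → ℤ) → Vec ℕ n → ℤ
∑geom     m []       ψ e = ψ e
∑geom {n} m (i ∷ is) ψ e = ∑ (upTo (suc (expAt m i))) (λ d → ∑geom m is ψ (e ⊕ d ⊙ unitN n i))

pair-geoms : ∀ {n} (m : Vec ℕ n) r s → s ℕ.+ r ≤ n → ∀ ψ e → Supp m ψ →
  pair m (prodS (Vec.map geomS (range r s))) (λ a → ψ (e ⊕ a)) ≡ ∑geom m (range r s) ψ e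
pair-geoms m zero s _ ψ e supp =
  trans (mono-represents 𝟘 .pair-≡ m _ (Supp-⊕ˡ supp e)) (cong ψ (⊕-identityʳ e))
pair-geoms {n} m (suc r) s s+r≤n ψ e supp = begin
  pair m (geomS s *S P) (λ a → ψ (e ⊕ a))
    ≡⟨ pair-*ˡ m (geomS s) P _ (Supp-⊕ˡ supp e) ⟩
  pair m (geomS s) (λ a → pair m P (λ c → ψ (e ⊕ (a ⊕ c))))
    ≡⟨ pair-geomS m s (ℕₚ.<-≤-trans (ℕₚ.m<m+n s (s≤s z≤n)) s+r≤n) _ (Supp-pair (Supp-⊕ˡ supp e) P) ⟩
  ∑ (upTo (suc (expAt m s))) (λ d → pair m P (λ c → ψ (e ⊕ (d ⊙ unitN n s ⊕ c))))
    ≡⟨ ∑-cong (upTo (suc (expAt m s))) (λ d → trans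
         (pair-cong m P (λ c → cong ψ (sym (⊕-assoc e (d ⊙ unitN n s) c))))
         (pair-geoms m r (suc s) (subst (_≤ n) (ℕₚ.+-suc s r) s+r≤n) ψ (e ⊕ d ⊙ unitN n s) supp)) ⟩
  ∑ (upTo (suc (expAt m s))) (λ d → ∑geom m (range r (suc s)) ψ (e ⊕ d ⊙ unitN n s)) ∎
  where
  P : Series n
  P = prodS (Vec.map geomS (range r (suc s)))

-- The remaining factors do not touch coordinates below `s`, so a mismatch there is permanent.
∑geom-vanish : ∀ {n} (m : Vec ℕ n) r s j e → j < s → expAt e j ≢ expAt m j → ∑geom m (range r s) (mono m) e ≡ 0ℤ
∑geom-vanish m zero    s j e j<s e≢m = mono-≢ m e (λ { refl → e≢m refl })
∑geom-vanish m (suc r) s j e j<s e≢m = ∑-zero (upTo (suc (expAt m s))) (λ d →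
  ∑geom-vanish m r (suc s) j _ (ℕₚ.m<n⇒m<1+n j<s)
    (e≢m ∘ trans (sym (expAt-⊕unit-≢ e d (ℕₚ.<⇒≢ j<s ∘ sym)))))

-- Each remaining coordinate has to be filled from `e_j` up to `m_j`, and for `e_j ≤ m_j` there is
-- exactly one power that does it.
∑geom-one : ∀ {n} (m : Vec ℕ n) r s e → s ℕ.+ r ≡ n → (∀ j → j < s → expAt e j ≡ expAt m j) →
            (∀ j → expAt e j ≤ expAt m j) → ∑geom m (range r s) (mono m) e ≡ 1ℤ
∑geom-one {n} m zero s e s≡n agree e≤m = trans (cong (mono m) (expAt-ext e≡m)) (mono-refl m)
  where
  e≡m : ∀ j → expAt e j ≡ expAt m j
  e≡m j with j ℕ.<? s
  ... | yes j<s = agree j j<s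
  ... | no  j≮s = trans (expAt-≥ e j n≤j) (sym (expAt-≥ m j n≤j))
    where
    n≤j : n ≤ j
    n≤j = subst (_≤ j) (trans (sym (ℕₚ.+-identityʳ s)) s≡n) (ℕₚ.≮⇒≥ j≮s)
∑geom-one {n} m (suc r) s e s+r≡n agree e≤m =
  trans (∑-single _ (s≤s (ℕₚ.m∸n≤m (expAt m s) (expAt e s))) others)
        (∑geom-one m r (suc s) e′ (trans (sym (ℕₚ.+-suc s r)) s+r≡n) agree′ e′≤m)
  where
  s<n : s < n
  s<n = subst (s <_) s+r≡n (ℕₚ.m<m+n s (s≤s z≤n))
  δ : ℕ
  δ = expAt m s ∸ expAt e s
  e′ : Vec ℕ n
  e′ = e ⊕ δ ⊙ unitN n s
  others : ∀ d → d ≢ δ → ∑geom m (range r (suc s)) (mono m) (e ⊕ d ⊙ unitN n s) ≡ 0ℤ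
  others d d≢δ = ∑geom-vanish m r (suc s) s _ ℕₚ.≤-refl (λ eq → d≢δ (trans (sym (ℕₚ.m+n∸m≡n (expAt e s) d))
    (cong (_∸ expAt e s) (trans (sym (expAt-⊕unit e d s s<n)) eq))))
  e′ₛ : expAt e′ s ≡ expAt m s
  e′ₛ = trans (expAt-⊕unit e δ s s<n) (ℕₚ.m+[n∸m]≡n (e≤m s))
  agree′ : ∀ j → j < suc s → expAt e′ j ≡ expAt m j
  agree′ j j<1+s with ℕₚ.m<1+n⇒m<n∨m≡n j<1+s
  ... | inj₁ j<s  = trans (expAt-⊕unit-≢ e δ (ℕₚ.<⇒≢ j<s ∘ sym)) (agree j j<s)
  ... | inj₂ refl = e′ₛ
  e′≤m : ∀ j → expAt e′ j ≤ expAt m j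
  e′≤m j with s ℕ.≟ j
  ... | yes refl = ℕₚ.≤-reflexive e′ₛ
  ... | no  s≢j  = subst (_≤ expAt m j) (sym (expAt-⊕unit-≢ e δ s≢j)) (e≤m j)

-- J k j β counts the sequences of j cards ending in β: the predecessors of β under
-- one card are the compositions (|β| - |γ|, γ) with γ ≤ β, zero parts removed.
J : ℕ → ℕ → List ℕ → ℤ
J k zero    β = 1ℤ
J k (suc j) β = ∑≤ β (λ γ → if does (sum β ∸ sum γ ℕ.≤? k) then J k j (strip (sum β ∸ sum γ ∷ γ)) else 0ℤ)

-- The lists have parts in `[k]` and length strictly below `c`. The choice `c = suc b` reaches all
-- compositions of `b`, whose length is at most `b`.
∑lists : ℕ → ℕ → (List ℕ → ℤ) → ℤ
∑lists k zero    φ = 0ℤ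
∑lists k (suc c) φ = φ [] + ∑ (upTo k) (λ p → ∑lists k c (λ β → φ (suc p ∷ β)))

∑lists-cong : ∀ k c {φ ψ} → (∀ β → φ β ≡ ψ β) → ∑lists k c φ ≡ ∑lists k c ψ
∑lists-cong k zero    eq = refl
∑lists-cong k (suc c) eq = cong₂ _+_ (eq []) (∑-cong (upTo k) (λ p → ∑lists-cong k c (λ β → eq (suc p ∷ β))))

module _ (k ℓ b : ℕ) where

  private
    n : ℕ
    n = suc ℓ
    M : Vec ℕ n
    M = b ∷ replicate ℓ k
    x : Vec ℕ n
    x = unitN n 0

  labels : ∀ j → Vec (Vec ℕ n) (suc j)
  labels j = 𝟘 ∷ tabulate (λ i → unitN n (suc (toℕ i)))

  tabulate-∷ʳ : ∀ {A : Set} (F : ℕ → A) j → tabulate {n = suc j} (F ∘ toℕ) ≡ tabulate {n = j} (F ∘ toℕ) ∷ʳ F j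
  tabulate-∷ʳ F zero    = refl
  tabulate-∷ʳ F (suc j) = cong (F 0 ∷_) (tabulate-∷ʳ (F ∘ suc) j)

  labels-suc : ∀ j → labels (suc j) ≡ labels j ∷ʳ unitN n (suc j)
  labels-suc j = cong (𝟘 ∷_) (tabulate-∷ʳ (unitN n ∘ suc) j)

  zvars-represent : ∀ j → AllRepresent (oneS ∷ zvars j) (labels j)
  zvars-represent j Fin.zero    = mono-represents 𝟘
  zvars-represent j (Fin.suc i) = subst₂ Represents (sym (Vecₚ.lookup∘tabulate _ i)) (sym (Vecₚ.lookup∘tabulate _ i))
                                    (mono-represents (unitN n (suc (toℕ i))))

  labels-expAt : ∀ j t → (t ≡ 0 ⊎ j < t) → ∀ i → expAt (lookup (labels j) i) t ≡ 0
  labels-expAt j t out Fin.zero    = expAt-𝟘 n t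
  labels-expAt j t out (Fin.suc i) = trans (cong (λ u → expAt u t) (Vecₚ.lookup∘tabulate _ i)) (expAt-unit-≢ n _ t (apart out))
    where
    apart : (t ≡ 0 ⊎ j < t) → suc (toℕ i) ≢ t
    apart (inj₁ refl) ()
    apart (inj₂ j<t)  refl = ℕₚ.<⇒≱ j<t (Finₚ.toℕ<n i)

  -- The labels `1, z_1, …, z_j` involve neither `x` nor any `z_t` with `t > j`, so these exponents
  -- stay constant along all moves of `H` and `B`.
  Closed-labels : ∀ j t → (t ≡ 0 ⊎ j < t) → (Q : ℕ → Set) → Closed (labels j) (λ e → Q (expAt e t))
  Closed-labels j t out Q i q {e} = subst Q (sym (trans (expAt-⊕ e _ t) (trans
    (cong (expAt e t ℕ.+_) (trans (expAt-⊙ q (lookup (labels j) i) t) (trans (cong (q ℕ.*_) (labels-expAt j t out i)) (ℕₚ.*-zeroʳ q))))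
    (ℕₚ.+-identityʳ _))))

  geoms : Series n
  geoms = prodS (Vec.map (λ i → geomS (suc (toℕ i))) (allFin ℓ))

  geoms-range : geoms ≡ prodS (Vec.map geomS (range ℓ 1))
  geoms-range = cong prodS (trans (sym (Vecₚ.tabulate-∘ _ id)) (tabulate-range ℓ geomS 1))

  -- weight j is the image of the coefficient functional under the adjoints of D_{z₁}, …, D_{z₁,…,z_j}.
  weight : ℕ → Vec ℕ n → ℤ
  weight zero    e = ∑geom M (range ℓ 1) (mono M) e
  weight (suc j) e = H (labels j) (expAt e (suc j)) (weight j) e

  weight0-pair : ∀ e → weight 0 e ≡ pair M geoms (λ a → mono M (e ⊕ a))
  weight0-pair e = sym (trans (cong (λ F → pair M F (λ a → mono M (e ⊕ a))) geoms-range)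
                              (pair-geoms M ℓ 1 ℕₚ.≤-refl (mono M) e (Supp-mono M)))

  Supp-weight : ∀ j → Supp M (weight j)
  Supp-weight zero    .vanishes e t lt = trans (weight0-pair e) (Supp-pair (Supp-mono M) geoms .vanishes e t lt)
  Supp-weight (suc j) .vanishes e t lt = H-Supp (labels j) (expAt e (suc j)) (Supp-weight j) .vanishes e t lt

  weight-vanish : ∀ j e → expAt e 0 ≢ b → weight j e ≡ 0ℤ
  weight-vanish zero    e e₀≢b = ∑geom-vanish M ℓ 1 0 e (s≤s z≤n) e₀≢b
  weight-vanish (suc j) e e₀≢b = H-vanish-on (labels j) (expAt e (suc j)) (λ e → expAt e 0 ≢ b)
    (Closed-labels j 0 (inj₁ refl) (_≢ b)) (weight-vanish j) e e₀≢b

  pair-Dchain : ∀ j F → pair M (Dchain j F) (weight 0) ≡ pair M F (weight j)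
  pair-Dchain zero          F = refl
  -- `Dchain` contains no `D_{z_1}`, whereas `weight` has a step for `z_1` as for every other
  -- variable; that step is the identity.
  pair-Dchain (suc zero)    F = pair-cong M F (λ e → sym (H-𝟘 (expAt e 1) (weight 0) e))
  pair-Dchain (suc (suc j)) F = trans (pair-Dchain (suc j) (Dop (suc (suc j)) F))
    (pair-Dop M (suc (suc j)) (labels (suc j)) (zvars-represent (suc j)) F (weight (suc j)) (Supp-weight (suc j)))

  RHScoeff-pair : ∀ G → RHScoeff k ℓ G b ≡ pair M G (weight ℓ)
  RHScoeff-pair G = begin
    (geoms *S Dchain ℓ G) M                                          ≡⟨ sym (pair-mono M (geoms *S Dchain ℓ G)) ⟩
    pair M (geoms *S Dchain ℓ G) (mono M)                            ≡⟨ pair-*ʳ M geoms (Dchain ℓ G) (mono M) (Supp-mono M) ⟩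
    pair M (Dchain ℓ G) (λ c → pair M geoms (λ a → mono M (c ⊕ a)))  ≡⟨ pair-cong M (Dchain ℓ G) (λ e → sym (weight0-pair e)) ⟩
    pair M (Dchain ℓ G) (weight 0)                                   ≡⟨ pair-Dchain ℓ G ⟩
    pair M G (weight ℓ)                                              ∎

  expAt-M : ∀ j → 1 ≤ j → j ≤ ℓ → expAt M j ≡ k
  expAt-M (suc j) _ j<ℓ = expAt-replicate ℓ k j j<ℓ

  -- The situation with `j` cards still to be removed: for `t > j` the exponent of `z_t` already
  -- holds the size of the group dropped by the t-th card, and `z_1, …, z_j` are untouched.
  record Fresh (j : ℕ) (e : Vec ℕ n) : Set where
    field
      balls : expAt e 0 ≡ b
      inBox : ∀ t → expAt e t ≤ expAt M t
      unused : ∀ t → 1 ≤ t → t ≤ j → expAt e t ≡ 0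
  open Fresh

  Fresh-throw : ∀ {j e N} → suc j ≤ ℓ → N ≤ k → Fresh (suc j) e → Fresh j (e ⊕ N ⊙ unitN n (suc j))
  Fresh-throw {j} {e} {N} j<ℓ N≤k fr .balls = trans (expAt-⊕unit-≢ e N {suc j} {0} (λ ())) (fr .balls)
  Fresh-throw {j} {e} {N} j<ℓ N≤k fr .inBox t with suc j ℕ.≟ t
  ... | yes refl = subst₂ _≤_ (sym (trans (expAt-⊕unit e N (suc j) (s≤s j<ℓ)) (cong (ℕ._+ N) (fr .unused (suc j) (s≤s z≤n) ℕₚ.≤-refl))))
                     (sym (expAt-M (suc j) (s≤s z≤n) j<ℓ)) N≤k
  ... | no  j≢t  = subst (_≤ expAt M t) (sym (expAt-⊕unit-≢ e N j≢t)) (fr .inBox t)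
  Fresh-throw {j} {e} {N} j<ℓ N≤k fr .unused t 1≤t t≤j =
    trans (expAt-⊕unit-≢ e N {suc j} {t} (λ { refl → ℕₚ.<-irrefl refl t≤j })) (fr .unused t 1≤t (ℕₚ.m≤n⇒m≤1+n t≤j))

  -- The value does not depend on `e`, because whatever exponents the removed cards have left are
  -- topped up to `k` by the geometric series in exactly one way.
  B-weight : ∀ j → j ≤ ℓ → ∀ β e → Fresh j e → B (labels j) β (weight j) e ≡ J k j β
  B-weight zero _ β e fr = trans (invariant β (weight 0) e)
    (∑geom-one M ℓ 1 e refl (λ { zero _ → fr .balls ; (suc j) (s≤s ()) }) (fr .inBox))
    where
    invariant : ∀ β g e → B (labels 0) β g e ≡ g e
    invariant []      g e = refl
    invariant (p ∷ β) g e = trans (invariant β (H (𝟘 ∷ []) p g) e) (H-𝟘 p g e)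
  B-weight (suc j) j<ℓ β e fr = begin
    B (labels (suc j)) β (weight (suc j)) e
      ≡⟨ cong (λ us → B us β (weight (suc j)) e) (labels-suc j) ⟩
    B (labels j ∷ʳ z) β (weight (suc j)) e
      ≡⟨ B-∷ʳ (labels j) z β (weight (suc j)) e ⟩
    ∑≤ β (λ γ → B (labels j) γ (weight (suc j)) (e ⊕ (sum β ∸ sum γ) ⊙ z))
      ≡⟨ ∑≤-cong β (λ {γ} _ → step γ) ⟩
    J k (suc j) β ∎
    where
    z : Vec ℕ n
    z = unitN n (suc j)
    step : ∀ γ → B (labels j) γ (weight (suc j)) (e ⊕ (sum β ∸ sum γ) ⊙ z) ≡
                 (if does (sum β ∸ sum γ ℕ.≤? k) then J k j (strip (sum β ∸ sum γ ∷ γ)) else 0ℤ)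
    step γ = trans release (capacity (sum β ∸ sum γ ℕ.≤? k))
      where
      N : ℕ
      N = sum β ∸ sum γ
      e′ : Vec ℕ n
      e′ = e ⊕ N ⊙ z
      e′ⱼ : expAt e′ (suc j) ≡ N
      e′ⱼ = trans (expAt-⊕unit e N (suc j) (s≤s j<ℓ)) (cong (ℕ._+ N) (fr .unused (suc j) (s≤s z≤n) ℕₚ.≤-refl))
      -- All exponents reached from `e′` have power `N` of `z_{j+1}`, so `weight (suc j)` acts as
      -- `H (labels j) N` of fixed degree applied to `weight j`, and `B` absorbs it as an additional
      -- first part `N`.
      release : B (labels j) γ (weight (suc j)) e′ ≡ B (labels j) (strip (N ∷ γ)) (weight j) e′
      release = trans
        (B-cong-on (labels j) γ (λ e → expAt e (suc j) ≡ N) (Closed-labels j (suc j) (inj₂ ℕₚ.≤-refl) (_≡ N))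
          (λ e eq → cong (λ p → H (labels j) p (weight j) e) eq) e′ e′ⱼ)
        (sym (B-strip (labels j) (N ∷ γ) (weight j) e′))
      capacity : (N≤?k : Dec (N ≤ k)) → B (labels j) (strip (N ∷ γ)) (weight j) e′ ≡ (if does N≤?k then J k j (strip (N ∷ γ)) else 0ℤ)
      capacity (yes N≤k) = B-weight j (ℕₚ.<⇒≤ j<ℓ) (strip (N ∷ γ)) e′ (Fresh-throw j<ℓ N≤k fr)
      -- Starting from `N > k` the power of `z_{j+1}` never decreases, so every evaluation lies
      -- outside the box.
      capacity (no  N≰k) = B-vanish-on (labels j) (strip (N ∷ γ)) (λ e → expAt M (suc j) < expAt e (suc j)) (Closed-> (labels j) _ (suc j))
        (λ e lt → Supp-weight j .vanishes e (suc j) lt) e′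
        (subst₂ _<_ (sym (expAt-M (suc j) (s≤s z≤n) j<ℓ)) (sym e′ⱼ) (ℕₚ.≰⇒> N≰k))

  -- Unfolding the inverse of 2 - h_k

  Hk-arguments : Vec (Series n) (suc (suc ℓ))
  Hk-arguments = oneS ∷ var 0 ∷ Vec.map (λ i → var 0 *S var (suc (toℕ i))) (allFin ℓ)

  -- The argument `x` is `x` times the label `1`, so all arguments after the leading `1` are `x`
  -- times a label.
  Hk-exponents : Vec (Vec ℕ n) (suc (suc ℓ))
  Hk-exponents = 𝟘 ∷ Vec.map (x ⊕_) (labels ℓ)

  Hk-represent : AllRepresent Hk-arguments Hk-exponents
  Hk-represent Fin.zero              = mono-represents 𝟘
  Hk-represent (Fin.suc Fin.zero)    = subst (Represents (var 0)) (sym (⊕-identityʳ x)) (mono-represents x)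
  Hk-represent (Fin.suc (Fin.suc i)) = subst₂ Represents
    (sym (trans (Vecₚ.lookup-map i _ (allFin ℓ)) (cong (λ i → var 0 *S var (suc (toℕ i))) (Vecₚ.lookup∘tabulate id i))))
    (sym (trans (Vecₚ.lookup-map i (x ⊕_) zs) (cong (x ⊕_) (Vecₚ.lookup∘tabulate (λ i → unitN n (suc (toℕ i))) i))))
    (*-represents (mono-represents x) (mono-represents (unitN n (suc (toℕ i)))))
    where
    zs : Vec (Vec ℕ n) ℓ
    zs = tabulate (λ i → unitN n (suc (toℕ i)))

  addPart : (Vec ℕ n → ℤ) → ℕ → Vec ℕ n → ℤ
  addPart g p e = H (labels ℓ) p g (e ⊕ p ⊙ x)

  -- The argument `1` absorbs the missing degree `k - p`, whence
  -- `h_k(1, x v) = Σ_{p ≤ k} x^p h_p(v)`. The term `p = 0` is 1 and turns the 2 of the denominator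
  -- into the 1 of a geometric series.
  H-Hk : ∀ g e → H Hk-exponents k g e ≡ g e + ∑ (upTo k) (λ p → addPart g (suc p) e)
  H-Hk g e = begin
    ∑ K (λ q → H (Vec.map (x ⊕_) (labels ℓ)) (k ∸ q) g (e ⊕ q ⊙ 𝟘))
      ≡⟨ ∑-cong K (λ q → trans (cong (H (Vec.map (x ⊕_) (labels ℓ)) (k ∸ q) g) (⊕-⊙𝟘 e q)) (H-pull x (labels ℓ) (k ∸ q) g e)) ⟩
    ∑ K (λ q → addPart g (k ∸ q) e)
      ≡⟨ sym (∑-reflect k (λ p → addPart g p e)) ⟩
    ∑ K (λ p → addPart g p e)
      ≡⟨ ∑-suc k _ ⟩
    addPart g 0 e + ∑ (upTo k) (λ p → addPart g (suc p) e)
      ≡⟨ cong (_+ ∑ (upTo k) (λ p → addPart g (suc p) e)) (trans (H-degree0 (labels ℓ) g _) (cong g (⊕-0⊙ e x))) ⟩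
    g e + ∑ (upTo k) (λ p → addPart g (suc p) e) ∎
    where
    K : List ℕ
    K = upTo (suc k)

  Supp-addPart : ∀ {g} p → Supp M g → Supp M (addPart g p)
  Supp-addPart p supp = Supp-⊕ (H-Supp (labels ℓ) p supp) (p ⊙ x)

  -- A new part has size at least 1 and raises the exponent of `x`, so the bound from which the test
  -- function vanishes drops by one. This makes the unfolding of `G` terminate.
  addPart-vanish : ∀ c {g} → (∀ e → suc c ≤ expAt e 0 → g e ≡ 0ℤ) → ∀ p e → c ≤ expAt e 0 → addPart g (suc p) e ≡ 0ℤ
  addPart-vanish c vanish p e c≤e = H-vanish-on (labels ℓ) (suc p) (λ e → c < expAt e 0) (Closed-> (labels ℓ) c 0) vanish _
    (ℕₚ.<-≤-trans (s≤s c≤e) (ℕₚ.≤-trans (ℕₚ.m<m+n (expAt e 0) (s≤s z≤n)) (ℕₚ.≤-reflexive (sym (expAt-⊕unit e (suc p) 0 (s≤s z≤n))))))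

  module _ (G : Series n) (inverse : IsInverseOf2-Hk k ℓ G) where

    -- Adjoint form of `G = 1 + G · Σ_{1 ≤ p ≤ k} x^p h_p(1, z_1, …, z_ℓ)`. Only the equation of `G`
    -- enters; its coefficients are never computed.
    pair-G : ∀ g → Supp M g → pair M G g ≡ g 𝟘 + ∑ (upTo k) (λ p → pair M G (addPart g (suc p)))
    pair-G g supp = begin
      pair M G g
        -- Here `g` is written as the adjoint of `2 - h_k` applied to `g`, plus the correction `T`.
        ≡⟨ ∑-cong (below M) (λ a → split (G a) (g a) (T a)) ⟩
      ∑ (below M) (λ a → G a * (ℤ.+ 2 * g a + -1ℤ * (g a + T a)) + G a * T a)
        ≡⟨ ∑-+ (below M) _ _ ⟩
      pair M G (λ a → ℤ.+ 2 * g a + -1ℤ * (g a + T a)) + pair M G T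
        ≡⟨ cong₂ _+_ (trans (pair-cong M G (λ a → sym (pair-2-Hk a))) (trans (sym (pair-*ˡ M G (constS (ℤ.+ 2) -S Hk k ℓ) g supp))
             (trans (pair-congˡ M g inverse) (mono-represents 𝟘 .pair-≡ M g supp))))
             (trans (∑-cong (below M) (λ a → ∑-*ˡ (upTo k) (G a) _)) (∑-swap (below M) (upTo k) _)) ⟩
      g 𝟘 + ∑ (upTo k) (λ p → pair M G (addPart g (suc p))) ∎
      where
      T : Vec ℕ n → ℤ
      T a = ∑ (upTo k) (λ p → addPart g (suc p) a)
      split : ∀ u v w → u * v ≡ u * (ℤ.+ 2 * v + -1ℤ * (v + w)) + u * w
      split = solve-∀
      distribute : ∀ o h v → (ℤ.+ 2 * o ℤ.- h) * v ≡ ℤ.+ 2 * (o * v) + -1ℤ * (h * v)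
      distribute = solve-∀
      pair-2-Hk : ∀ a → pair M (constS (ℤ.+ 2) -S Hk k ℓ) (λ c → g (a ⊕ c)) ≡ ℤ.+ 2 * g a + -1ℤ * (g a + T a)
      pair-2-Hk a = begin
        ∑ (below M) (λ c → (ℤ.+ 2 * oneS c ℤ.- Hk k ℓ c) * g (a ⊕ c))
          ≡⟨ ∑-cong (below M) (λ c → distribute (oneS c) (Hk k ℓ c) (g (a ⊕ c))) ⟩
        ∑ (below M) (λ c → ℤ.+ 2 * (oneS c * g (a ⊕ c)) + -1ℤ * (Hk k ℓ c * g (a ⊕ c)))
          ≡⟨ ∑-+ (below M) _ _ ⟩
        ∑ (below M) (λ c → ℤ.+ 2 * (oneS c * g (a ⊕ c))) + ∑ (below M) (λ c → -1ℤ * (Hk k ℓ c * g (a ⊕ c)))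
          ≡⟨ cong₂ _+_ (sym (∑-*ˡ (below M) (ℤ.+ 2) _)) (sym (∑-*ˡ (below M) -1ℤ _)) ⟩
        ℤ.+ 2 * pair M oneS (λ c → g (a ⊕ c)) + -1ℤ * pair M (Hk k ℓ) (λ c → g (a ⊕ c))
          ≡⟨ cong₂ (λ y z → ℤ.+ 2 * y + -1ℤ * z)
               (trans (mono-represents 𝟘 .pair-≡ M _ (Supp-⊕ˡ supp a)) (cong g (⊕-identityʳ a)))
               (trans (pair-hS M k Hk-arguments Hk-exponents Hk-represent g a supp) (H-Hk g a)) ⟩
        ℤ.+ 2 * g a + -1ℤ * (g a + T a) ∎

    -- Each use of `pair-G` either ends the list or adds one part to it, and the shifts by `p ⊙ x`
    -- add up to `sum β ⊙ x`. After `c` rounds the test function is zero everywhere.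
    pair-G-lists : ∀ c g → Supp M g → (∀ e → c ≤ expAt e 0 → g e ≡ 0ℤ) →
                   pair M G g ≡ ∑lists k c (λ β → B (labels ℓ) β g (sum β ⊙ x))
    pair-G-lists zero    g supp vanish = ∑-zero (below M) (λ e → trans (cong (G e *_) (vanish e z≤n)) (ℤₚ.*-zeroʳ (G e)))
    pair-G-lists (suc c) g supp vanish = trans (pair-G g supp) (cong₂ _+_ (cong g (sym (0⊙ x))) (∑-cong (upTo k) (λ p →
      trans (pair-G-lists c (addPart g (suc p)) (Supp-addPart (suc p) supp) (addPart-vanish c vanish p))
            (∑lists-cong k c (λ β → trans (B-shift (labels ℓ) β (H (labels ℓ) (suc p) g) (suc p ⊙ x) (sum β ⊙ x))
              (cong (B (labels ℓ) β (H (labels ℓ) (suc p) g)) (trans (⊕-comm (sum β ⊙ x) (suc p ⊙ x)) (sym (⊙-distribʳ (suc p) (sum β) x)))))))))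

    RHScoeff-J : RHScoeff k ℓ G b ≡ ∑lists k (suc b) (λ β → if does (sum β ℕ.≟ b) then J k ℓ β else 0ℤ)
    RHScoeff-J = begin
      RHScoeff k ℓ G b     ≡⟨ RHScoeff-pair G ⟩
      -- The bound is `suc b` because `weight ℓ` vanishes as soon as the exponent of `x` exceeds
      -- `b`, the first entry of `M`.
      pair M G (weight ℓ)  ≡⟨ pair-G-lists (suc b) (weight ℓ) (Supp-weight ℓ) (λ e → Supp-weight ℓ .vanishes e 0) ⟩
      ∑lists k (suc b) (λ β → B (labels ℓ) β (weight ℓ) (sum β ⊙ x))
        ≡⟨ ∑lists-cong k (suc b) (λ β → size β (sum β ℕ.≟ b)) ⟩
      ∑lists k (suc b) (λ β → if does (sum β ℕ.≟ b) then J k ℓ β else 0ℤ) ∎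
      where
      fresh : Fresh ℓ (b ⊙ x)
      fresh .balls = expAt-⊙unit n b 0 (s≤s z≤n)
      fresh .inBox zero    = ℕₚ.≤-reflexive (expAt-⊙unit n b 0 (s≤s z≤n))
      fresh .inBox (suc t) = subst (_≤ expAt M (suc t)) (sym (expAt-⊙unit-≢ n b {0} {suc t} (λ ()))) z≤n
      fresh .unused (suc t) _ _ = expAt-⊙unit-≢ n b {0} {suc t} (λ ())
      size : ∀ β (s : Dec (sum β ≡ b)) → B (labels ℓ) β (weight ℓ) (sum β ⊙ x) ≡ (if does s then J k ℓ β else 0ℤ)
      size β (yes eq) = trans (cong (λ s → B (labels ℓ) β (weight ℓ) (s ⊙ x)) eq) (B-weight ℓ ℕₚ.≤-refl β (b ⊙ x) fresh)
      size β (no neq) = B-vanish-on (labels ℓ) β (λ e → expAt e 0 ≢ b) (Closed-labels ℓ 0 (inj₁ refl) (_≢ b))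
        (weight-vanish ℓ) (sum β ⊙ x) (neq ∘ trans (sym (expAt-⊙unit n (sum β) 0 (s≤s z≤n))))

-- Counting card sequences

-- The value is an integer because it is compared with coefficients of series. Each kind of sum gets
-- a lemma that produces the matching dependent sum of types, so the bijection is built along the
-- recursion for `J`.
Counted : ℤ → Set → Set
Counted z X = Σ ℕ (λ n → (Fin n ↔ X) × (ℤ.+ n ≡ z))

counted-≡ : ∀ {X z w} → z ≡ w → Counted z X → Counted w X
counted-≡ refl c = c

counted-↔ : ∀ {X Y z} → X ↔ Y → Counted z X → Counted z Y
counted-↔ X↔Y (n , e , eq) = n , ↔-trans e X↔Y , eq

counted-empty : ∀ {X} → ¬ X → Counted 0ℤ X
counted-empty ¬x = 0 , mk↔ₛ′ (λ ()) (λ x → contradiction x ¬x) (λ x → contradiction x ¬x) (λ ()) , refl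

counted-⊤ : Counted 1ℤ ⊤
counted-⊤ = 1 , Finₚ.1↔⊤ , refl

counted-⊎ : ∀ {X Y z w} → Counted z X → Counted w Y → Counted (z + w) (X ⊎ Y)
counted-⊎ (m , X↔ , eq) (n , Y↔ , eq′) =
  m ℕ.+ n , ↔-trans Finₚ.+↔⊎ (X↔ ⊎-↔ Y↔) , trans (ℤₚ.pos-+ m n) (cong₂ _+_ eq eq′)

-- Irrelevance of `P` prevents different proofs of the condition from being counted separately.
counted-if : ∀ {P X z} (P? : Dec P) → Irrelevant P → (P → Counted z X) →
             Counted (if does P? then z else 0ℤ) (P × X)
counted-if (yes p) irr c = counted-↔ (mk↔ₛ′ (p ,_) proj₂ (λ { (q , x) → cong (_, x) (irr p q) }) (λ _ → refl)) (c p)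
counted-if (no ¬p) irr c = counted-empty (¬p ∘ proj₁)

counted-∑ : ∀ n {φ} {X : ℕ → Set} → (∀ i → i < n → Counted (φ i) (X i)) →
            Counted (∑ (upTo n) φ) (Σ ℕ (λ i → i < n × X i))
counted-∑ zero    {φ} c = counted-≡ (sym (∑-[] φ)) (counted-empty (λ { (_ , () , _) }))
counted-∑ (suc n) {φ} {X} c = counted-≡ (sym (∑-suc n φ))
  (counted-↔ cases (counted-⊎ (c 0 (s≤s z≤n)) (counted-∑ n (λ i i<n → c (suc i) (s≤s i<n)))))
  where
  cases : (X 0 ⊎ Σ ℕ (λ i → i < n × X (suc i))) ↔ Σ ℕ (λ i → i < suc n × X i)
  cases = mk↔ₛ′
    (λ { (inj₁ x) → 0 , s≤s z≤n , x ; (inj₂ (i , i<n , x)) → suc i , s≤s i<n , x })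
    (λ { (zero , _ , x) → inj₁ x ; (suc i , s≤s i<n , x) → inj₂ (i , i<n , x) })
    (λ { (zero , s≤s z≤n , x) → refl ; (suc i , s≤s i<n , x) → refl })
    (λ { (inj₁ x) → refl ; (inj₂ _) → refl })

counted-∑≤ : ∀ β {φ} {X : List ℕ → Set} → (∀ γ → Pointwise _≤_ γ β → Counted (φ γ) (X γ)) →
             Counted (∑≤ β φ) (Σ (List ℕ) (λ γ → Pointwise _≤_ γ β × X γ))
counted-∑≤ []      c = counted-↔ (mk↔ₛ′ (λ x → [] , [] , x) (λ { ([] , [] , x) → x }) (λ { ([] , [] , x) → refl }) (λ _ → refl)) (c [] [])
counted-∑≤ (p ∷ β) {φ} {X} c = counted-↔ assoc
  (counted-∑≤ β (λ γ γ≤β → counted-∑ (suc p) (λ r r<1+p → c (r ∷ γ) (ℕₚ.≤-pred r<1+p ∷ γ≤β))))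
  where
  assoc : Σ (List ℕ) (λ γ → Pointwise _≤_ γ β × Σ ℕ (λ r → r < suc p × X (r ∷ γ))) ↔ Σ (List ℕ) (λ γ → Pointwise _≤_ γ (p ∷ β) × X γ)
  assoc = mk↔ₛ′
    (λ { (γ , γ≤β , r , s≤s r≤p , x) → r ∷ γ , r≤p ∷ γ≤β , x })
    (λ { (r ∷ γ , r≤p ∷ γ≤β , x) → γ , γ≤β , r , s≤s r≤p , x })
    (λ { (r ∷ γ , r≤p ∷ γ≤β , x) → refl })
    (λ { (γ , γ≤β , r , s≤s r≤p , x) → refl })

Parts : ℕ → List ℕ → Set
Parts k = All (λ p → 1 ≤ p × p ≤ k)

counted-∑lists : ∀ k c {φ} {X : List ℕ → Set} → (∀ β → Parts k β → Counted (φ β) (X β)) →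
                 Counted (∑lists k c φ) (Σ (List ℕ) (λ β → Parts k β × length β < c × X β))
counted-∑lists k zero    f = counted-empty (λ { (_ , _ , () , _) })
counted-∑lists k (suc c) {φ} {X} f = counted-↔ cases
  (counted-⊎ (f [] []) (counted-∑ k (λ p p<k → counted-∑lists k c (λ β parts → f (suc p ∷ β) ((s≤s z≤n , p<k) ∷ parts)))))
  where
  cases : (X [] ⊎ Σ ℕ (λ p → p < k × Σ (List ℕ) (λ β → Parts k β × length β < c × X (suc p ∷ β)))) ↔
          Σ (List ℕ) (λ β → Parts k β × length β < suc c × X β)
  cases = mk↔ₛ′
    (λ { (inj₁ x) → [] , [] , s≤s z≤n , x
       ; (inj₂ (p , p<k , β , parts , l<c , x)) → suc p ∷ β , (s≤s z≤n , p<k) ∷ parts , s≤s l<c , x })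
    (λ { ([] , _ , _ , x) → inj₁ x
       ; (suc p ∷ β , (_ , p<k) ∷ parts , s≤s l<c , x) → inj₂ (p , p<k , β , parts , l<c , x) })
    (λ { ([] , [] , s≤s z≤n , x) → refl
       ; (suc p ∷ β , (s≤s z≤n , p<k) ∷ parts , s≤s l<c , x) → refl })
    (λ { (inj₁ x) → refl ; (inj₂ _) → refl })

bijective⇒↔ : {X Y : Set} (to : X → Y) → (∀ {x y} → to x ≡ to y → x ≡ y) → (∀ y → Σ X (λ x → to x ≡ y)) → X ↔ Y
bijective⇒↔ to inj surj = mk↔ₛ′ to (proj₁ ∘ surj) (proj₂ ∘ surj) (λ x → inj (proj₂ (surj (to x))))

-- The increasing enumeration of the indices j with δ_j ≠ 0; for δ = (N, γ) it is the map f of a card.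
support : ∀ {δ β} → Pointwise _≤_ δ β → Vec (Fin (length β)) (length (strip δ))
support []                  = []
support (_∷_ {zero}  _ δ≤β) = Vec.map Fin.suc (support δ≤β)
support (_∷_ {suc a} _ δ≤β) = Fin.zero ∷ Vec.map Fin.suc (support δ≤β)

Increasing : ∀ {m n} → Vec (Fin m) n → Set
Increasing {n = n} f = (i j : Fin n) → i Fin.< j → lookup f i Fin.< lookup f j

-- Applied to cards with `k ∷ departure` for `β`: the value 0 of `f` is then the index of the entry
-- `k`, and the capacity bound on the dropped group becomes one more instance of fitting.
Fits : (α β : List ℕ) → Vec (Fin (length β)) (length α) → Set
Fits α β f = ∀ i → List.lookup α i ≤ List.lookup β (lookup f i)

lookup-map-suc : ∀ {m n} (f : Vec (Fin m) n) i → lookup (Vec.map Fin.suc f) i ≡ Fin.suc (lookup f i)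
lookup-map-suc f i = Vecₚ.lookup-map i Fin.suc f

Increasing-map-suc : ∀ {m n} (f : Vec (Fin m) n) → Increasing f → Increasing (Vec.map Fin.suc f)
Increasing-map-suc f inc i j i<j rewrite lookup-map-suc f i | lookup-map-suc f j = s≤s (inc i j i<j)

Increasing-map-suc⁻ : ∀ {m n} (f : Vec (Fin m) n) → Increasing (Vec.map Fin.suc f) → Increasing f
Increasing-map-suc⁻ f inc i j i<j = ℕₚ.≤-pred (subst₂ Fin._<_ (lookup-map-suc f i) (lookup-map-suc f j) (inc i j i<j))

support-increasing : ∀ {δ β} (δ≤β : Pointwise _≤_ δ β) → Increasing (support δ≤β)
support-increasing (_∷_ {zero}  _ δ≤β) = Increasing-map-suc (support δ≤β) (support-increasing δ≤β)
support-increasing (_∷_ {suc a} _ δ≤β) Fin.zero    (Fin.suc j) _         rewrite lookup-map-suc (support δ≤β) j = s≤s z≤n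
support-increasing (_∷_ {suc a} _ δ≤β) (Fin.suc i) (Fin.suc j) (s≤s i<j) = Increasing-map-suc (support δ≤β) (support-increasing δ≤β) i j i<j

support-fits : ∀ {δ β} (δ≤β : Pointwise _≤_ δ β) → Fits (strip δ) β (support δ≤β)
support-fits (_∷_ {zero}  _   δ≤β) i           rewrite lookup-map-suc (support δ≤β) i = support-fits δ≤β i
support-fits (_∷_ {suc a} a≤p δ≤β) Fin.zero    = a≤p
support-fits (_∷_ {suc a} _   δ≤β) (Fin.suc i) rewrite lookup-map-suc (support δ≤β) i = support-fits δ≤β i

strip-positive : ∀ δ → All (1 ≤_) (strip δ)
strip-positive []          = []
strip-positive (zero ∷ δ)  = strip-positive δ
strip-positive (suc a ∷ δ) = s≤s z≤n ∷ strip-positive δ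

strip-All : ∀ {P : ℕ → Set} {δ} → All P δ → All P (strip δ)
strip-All {δ = []}        []       = []
strip-All {δ = zero ∷ δ}  (_ ∷ ps) = strip-All {δ = δ} ps
strip-All {δ = suc a ∷ δ} (p ∷ ps) = p ∷ strip-All ps

sum-strip : ∀ δ → sum (strip δ) ≡ sum δ
sum-strip []          = refl
sum-strip (zero ∷ δ)  = sum-strip δ
sum-strip (suc a ∷ δ) = cong (suc a ℕ.+_) (sum-strip δ)

-- The type of the map depends on the length of `α`, so both are compared as one pair.
Landing : ℕ → Set
Landing m = Σ (List ℕ) (λ α → Vec (Fin m) (length α))

∷-landing-injective : ∀ {m a a′ α α′} {x x′ : Fin m} {f f′} →
  _≡_ {A = Landing m} (a ∷ α , x ∷ f) (a′ ∷ α′ , x′ ∷ f′) → a ≡ a′ × x ≡ x′ × _≡_ {A = Landing m} (α , f) (α′ , f′)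
∷-landing-injective refl = refl , refl , refl

map-suc-injective : ∀ {m n} {f f′ : Vec (Fin m) n} → Vec.map Fin.suc f ≡ Vec.map Fin.suc f′ → f ≡ f′
map-suc-injective {f = []}    {[]}     eq = refl
map-suc-injective {f = x ∷ f} {y ∷ f′} eq =
  cong₂ _∷_ (Finₚ.suc-injective (Vecₚ.∷-injectiveˡ eq)) (map-suc-injective (Vecₚ.∷-injectiveʳ eq))

map-suc-landing-injective : ∀ {m α α′} {f : Vec (Fin m) (length α)} {f′ : Vec (Fin m) (length α′)} →
  _≡_ {A = Landing (suc m)} (α , Vec.map Fin.suc f) (α′ , Vec.map Fin.suc f′) → _≡_ {A = Landing m} (α , f) (α′ , f′)
map-suc-landing-injective {α = α} eq with cong proj₁ eq
... | refl = cong (α ,_) (map-suc-injective (,-injectiveʳ eq))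

map-suc≢zero∷ : ∀ {m a α α′} {f : Vec (Fin m) (length α)} {f′ : Vec (Fin (suc m)) (length α′)} →
  _≢_ {A = Landing (suc m)} (α , Vec.map Fin.suc f) (a ∷ α′ , Fin.zero ∷ f′)
map-suc≢zero∷ {α = []}    {f = []}    ()
map-suc≢zero∷ {α = _ ∷ _} {f = _ ∷ _} ()

-- The enumeration keeps the positions that `strip` forgets: the first entry of `δ` is nonzero
-- exactly when the enumeration starts with index 0, and it is then the first part of `strip δ`.
support-injective : ∀ {δ δ′ β} (p : Pointwise _≤_ δ β) (q : Pointwise _≤_ δ′ β) →
  _≡_ {A = Landing (length β)} (strip δ , support p) (strip δ′ , support q) → δ ≡ δ′
support-injective []                []                eq = refl
support-injective (_∷_ {zero}  _ p) (_∷_ {zero}  _ q) eq = cong (0 ∷_) (support-injective p q (map-suc-landing-injective eq))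
support-injective (_∷_ {zero}  _ p) (_∷_ {suc _} _ q) eq = contradiction eq map-suc≢zero∷
support-injective (_∷_ {suc _} _ p) (_∷_ {zero}  _ q) eq = contradiction (sym eq) map-suc≢zero∷
support-injective (_∷_ {suc _} _ p) (_∷_ {suc _} _ q) eq with ∷-landing-injective eq
... | a≡ , _ , eq′ = cong₂ _∷_ a≡ (support-injective p q (map-suc-landing-injective eq′))

map-suc-surjective : ∀ {m n} (f : Vec (Fin (suc m)) n) → (∀ i → Fin.zero {m} Fin.< lookup f i) →
                     ∃ λ f′ → Vec.map Fin.suc f′ ≡ f
map-suc-surjective []              pos = [] , refl
map-suc-surjective (Fin.zero ∷ f)  pos = contradiction (pos Fin.zero) (λ ())
map-suc-surjective (Fin.suc x ∷ f) pos with map-suc-surjective f (pos ∘ Fin.suc)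
... | f′ , refl = x ∷ f′ , refl

-- An increasing `f` can take the value 0 only at its first argument. If it does, `δ` starts with
-- the first part of `α`, otherwise with 0; either way the rest of `f` factors through the
-- successor.
support-surjective : ∀ α β (f : Vec (Fin (length β)) (length α)) → All (1 ≤_) α → Increasing f → Fits α β f →
  Σ (List ℕ) (λ δ → Σ (Pointwise _≤_ δ β) (λ δ≤β → _≡_ {A = Landing (length β)} (strip δ , support δ≤β) (α , f)))
support-surjective []       []      []                  pos inc fits = [] , [] , refl
support-surjective []       (p ∷ β) []                  pos inc fits with support-surjective [] β [] [] (λ ()) (λ ())
... | δ , δ≤β , eq = 0 ∷ δ , z≤n ∷ δ≤β , cong (λ { (α , f) → α , Vec.map Fin.suc f }) eq
support-surjective (zero ∷ α) (p ∷ β) (Fin.zero ∷ f)  (() ∷ _) inc fits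
support-surjective (suc a ∷ α) (p ∷ β) (Fin.zero ∷ f)  (_ ∷ pos) inc fits with map-suc-surjective f (λ i → inc Fin.zero (Fin.suc i) (s≤s z≤n))
... | f′ , refl with support-surjective α β f′ pos (Increasing-map-suc⁻ f′ (λ i j i<j → inc (Fin.suc i) (Fin.suc j) (s≤s i<j)))
                       (λ i → subst (λ t → List.lookup α i ≤ List.lookup (p ∷ β) t) (lookup-map-suc f′ i) (fits (Fin.suc i)))
... | δ , δ≤β , eq = suc a ∷ δ , fits Fin.zero ∷ δ≤β , cong (λ { (α , f) → suc a ∷ α , Fin.zero ∷ Vec.map Fin.suc f }) eq
support-surjective (a ∷ α) (p ∷ β) (Fin.suc x ∷ f) pos inc fits with map-suc-surjective (Fin.suc x ∷ f)
  (λ { Fin.zero → s≤s z≤n ; (Fin.suc i) → ℕₚ.≤-<-trans z≤n (inc Fin.zero (Fin.suc i) (s≤s z≤n)) })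
... | f′ , eq′ with support-surjective (a ∷ α) β f′ pos (Increasing-map-suc⁻ f′ (subst Increasing (sym eq′) inc))
                       (λ i → subst (λ t → List.lookup (a ∷ α) i ≤ List.lookup (p ∷ β) t)
                                    (trans (cong (λ g → lookup g i) (sym eq′)) (lookup-map-suc f′ i)) (fits i))
... | δ , δ≤β , eq = 0 ∷ δ , z≤n ∷ δ≤β , trans (cong (λ { (α , f) → α , Vec.map Fin.suc f }) eq) (cong (a ∷ α ,_) eq′)

lookup-∷ʳ-inject₁ : ∀ {A : Set} {m} (xs : Vec A m) x i → lookup (xs ∷ʳ x) (inject₁ i) ≡ lookup xs i
lookup-∷ʳ-inject₁ (y ∷ xs) x Fin.zero    = refl
lookup-∷ʳ-inject₁ (y ∷ xs) x (Fin.suc i) = lookup-∷ʳ-inject₁ xs x i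

lookup-∷ʳ-fromℕ : ∀ {A : Set} {m} (xs : Vec A m) x → lookup (xs ∷ʳ x) (fromℕ m) ≡ x
lookup-∷ʳ-fromℕ []       x = refl
lookup-∷ʳ-fromℕ (y ∷ xs) x = lookup-∷ʳ-fromℕ xs x

-- Card sequences as chains of compositions

module _ (b k : ℕ) where

  -- Sequences of j cards ending in β, the last card first.
  CardsInto : ℕ → List ℕ → Set
  CardsInto zero    β = ⊤
  CardsInto (suc j) β = Σ (Card b k) (λ C → departure C ≡ β × CardsInto j (arrival C))

  record Valid (β : List ℕ) : Set where
    field
      positive : All (1 ≤_) β
      capped   : All (_≤ k) β
      size     : sum β ≡ b
  open Valid

  module _ {β : List ℕ} (valid : Valid β) where

    Valid-strip : ∀ {γ} → Pointwise _≤_ γ β → sum β ∸ sum γ ≤ k → Valid (strip (sum β ∸ sum γ ∷ γ))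
    Valid-strip {γ} γ≤β N≤k .positive = strip-positive (sum β ∸ sum γ ∷ γ)
    Valid-strip {γ} γ≤β N≤k .capped = strip-All {δ = sum β ∸ sum γ ∷ γ} (N≤k ∷ caps γ≤β (valid .capped))
      where
      caps : ∀ {γ β} → Pointwise _≤_ γ β → All (_≤ k) β → All (_≤ k) γ
      caps []          []       = []
      caps (r≤p ∷ γ≤β) (p ∷ ps) = ℕₚ.≤-trans r≤p p ∷ caps γ≤β ps
    Valid-strip {γ} γ≤β N≤k .size = trans (sum-strip (sum β ∸ sum γ ∷ γ)) (trans (ℕₚ.m∸n+n≡m (sum-mono γ≤β)) (valid .size))

    card : ∀ {γ} → Pointwise _≤_ γ β → sum β ∸ sum γ ≤ k → Card b k
    card {γ} γ≤β N≤k = record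
      { arrival        = strip (sum β ∸ sum γ ∷ γ)
      ; departure      = β
      ; f              = support (N≤k ∷ γ≤β)
      ; arrival-pos    = Valid-strip γ≤β N≤k .positive
      ; departure-pos  = valid .positive
      ; arrival-size   = Valid-strip γ≤β N≤k .size
      ; departure-size = valid .size
      ; arrival-cap    = Valid-strip γ≤β N≤k .capped
      ; departure-cap  = valid .capped
      ; f-incr         = support-increasing (N≤k ∷ γ≤β)
      ; f-fits         = λ i j eq → subst (λ t → _ ≤ List.lookup (k ∷ β) t) eq (support-fits (N≤k ∷ γ≤β) i)
      }

    -- The index set of the sum defining `J k (suc j) β`, in the form that `counted-∑≤` and
    -- `counted-if` produce.
    Removals : ℕ → Set
    Removals j = Σ (List ℕ) (λ γ → Pointwise _≤_ γ β × (sum β ∸ sum γ ≤ k) × CardsInto j (strip (sum β ∸ sum γ ∷ γ)))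

    addCard : ∀ {j} → Removals j → CardsInto (suc j) β
    addCard (γ , γ≤β , N≤k , cs) = card γ≤β N≤k , refl , cs

    -- Matching on the equation for the departure gives the maps of two cards the same codomain, so
    -- that `support-injective` can compare them.
    landing : ∀ {j} → CardsInto (suc j) β → Landing (suc (length β))
    landing (C , refl , _) = arrival C , f C

    addCard-injective : ∀ {j} {x y : Removals j} → addCard x ≡ addCard y → x ≡ y
    addCard-injective {x = γ , γ≤β , N≤k , cs} {γ′ , γ′≤β , N′≤k , cs′} eq
      with Listₚ.∷-injectiveʳ (support-injective (N≤k ∷ γ≤β) (N′≤k ∷ γ′≤β) (cong landing eq))
    ... | refl with Pointwise-irrelevant ℕₚ.≤-irrelevant γ≤β γ′≤β | ℕₚ.≤-irrelevant N≤k N′≤k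
    ... | refl | refl = cong (λ cs → γ , γ≤β , N≤k , cs) (,-injectiveʳ (,-injectiveʳ eq))

  -- The value 0 is covered by the capacity of the arrival, every other value by the fitting
  -- condition of the card. Both proofs are irrelevant and are recovered by decidability.
  fits-capped : ∀ α β (f : Vec (Fin (suc (length β))) (length α)) → .(All (_≤ k) α) →
    .((i : Fin (length α)) (j : Fin (length β)) → lookup f i ≡ Fin.suc j → List.lookup α i ≤ List.lookup β j) →
    Fits α (k ∷ β) f
  fits-capped α β f cap fits i with lookup f i in eq
  ... | Fin.zero  = All.lookup (recompute (All.all? (ℕ._≤? k) α) cap) (∈-lookup i)
  ... | Fin.suc j = recompute (List.lookup α i ℕ.≤? List.lookup β j) (fits i j eq)

  addCard-surjective : ∀ {β} (valid : Valid β) {j} (y : CardsInto (suc j) β) → Σ (Removals valid j) (λ x → addCard valid x ≡ y)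
  addCard-surjective valid (record { arrival = α ; departure = β ; f = f ; arrival-pos = pos ; arrival-size = size ; arrival-cap = cap
                                   ; f-incr = inc ; f-fits = fits } , refl , cs)
    with support-surjective α (k ∷ β) f (recompute (All.all? (1 ℕ.≤?_) α) pos)
           (λ i j i<j → recompute (lookup f i Fin.<? lookup f j) (inc i j i<j)) (fits-capped α β f cap fits)
  -- So far `N` is just some first entry; since arrival and departure both have size `b`, it must be
  -- `sum β ∸ sum γ`.
  ... | N ∷ γ , N≤k ∷ γ≤β , refl with trans (sym (ℕₚ.m+n∸n≡m N (sum γ)))
                                        (cong (_∸ sum γ) (trans (sym (sum-strip (N ∷ γ))) (trans (recompute (_ ℕ.≟ b) size) (sym (Valid.size valid)))))
  ... | refl = (γ , γ≤β , N≤k , cs) , refl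

  counted-J : ∀ j {β} → Valid β → Counted (J k j β) (CardsInto j β)
  counted-J zero    valid = counted-⊤
  counted-J (suc j) {β} valid = counted-↔ (bijective⇒↔ (addCard valid) (addCard-injective valid) (addCard-surjective valid))
    (counted-∑≤ β (λ γ γ≤β → counted-if (sum β ∸ sum γ ℕ.≤? k) ℕₚ.≤-irrelevant (λ N≤k → counted-J j (Valid-strip valid γ≤β N≤k))))

  sequence : ∀ j {β} → CardsInto j β → Vec (Card b k) j
  sequence zero    tt           = []
  sequence (suc j) (C , _ , cs) = sequence j cs ∷ʳ C

  Chain : ∀ {m} → Vec (Card b k) m → Set
  Chain {m} Cs = (i j : Fin m) → toℕ j ≡ suc (toℕ i) → departure (lookup Cs i) ≡ arrival (lookup Cs j)

  Chain-∷ʳ⁻ : ∀ {m} (Cs : Vec (Card b k) m) {D} → Chain (Cs ∷ʳ D) → Chain Cs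
  Chain-∷ʳ⁻ Cs {D} chain i j j≡1+i = subst₂ (λ C C′ → departure C ≡ arrival C′) (lookup-∷ʳ-inject₁ Cs D i) (lookup-∷ʳ-inject₁ Cs D j)
    (chain (inject₁ i) (inject₁ j) (trans (Finₚ.toℕ-inject₁ j) (trans j≡1+i (cong suc (sym (Finₚ.toℕ-inject₁ i))))))

  Chain-last : ∀ {m} (Cs : Vec (Card b k) m) C D → Chain ((Cs ∷ʳ C) ∷ʳ D) → departure C ≡ arrival D
  Chain-last {m} Cs C D chain = subst₂ (λ C C′ → departure C ≡ arrival C′)
    (trans (lookup-∷ʳ-inject₁ (Cs ∷ʳ C) D (fromℕ m)) (lookup-∷ʳ-fromℕ Cs C)) (lookup-∷ʳ-fromℕ (Cs ∷ʳ C) D)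
    (chain (inject₁ (fromℕ m)) (fromℕ (suc m)) (cong suc (sym (Finₚ.toℕ-inject₁ (fromℕ m)))))

  Chain-∷ʳ : ∀ {m} (Cs : Vec (Card b k) m) C D → Chain (Cs ∷ʳ C) → departure C ≡ arrival D → Chain ((Cs ∷ʳ C) ∷ʳ D)
  Chain-∷ʳ {m} Cs C D chain C→D i j j≡1+i with view i | view j
  ... | ‵fromℕ    | _          = contradiction (Finₚ.toℕ<n j) (ℕₚ.≤⇒≯ (ℕₚ.≤-reflexive (trans (cong (suc ∘ suc) (sym (Finₚ.toℕ-fromℕ m))) (sym j≡1+i))))
  ... | ‵inject₁ i′ | ‵inject₁ j′ rewrite lookup-∷ʳ-inject₁ (Cs ∷ʳ C) D i′ | lookup-∷ʳ-inject₁ (Cs ∷ʳ C) D j′ =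
    chain i′ j′ (trans (sym (Finₚ.toℕ-inject₁ j′)) (trans j≡1+i (cong suc (Finₚ.toℕ-inject₁ i′))))
  ... | ‵inject₁ i′ | ‵fromℕ rewrite lookup-∷ʳ-inject₁ (Cs ∷ʳ C) D i′ | lookup-∷ʳ-fromℕ (Cs ∷ʳ C) D =
    trans (cong departure (trans (cong (lookup (Cs ∷ʳ C)) i′≡) (lookup-∷ʳ-fromℕ Cs C))) C→D
    where
    i′≡ : i′ ≡ fromℕ m
    i′≡ = Finₚ.toℕ-injective (trans (sym (Finₚ.toℕ-inject₁ i′)) (sym (ℕₚ.suc-injective j≡1+i)))

  -- The following card `D` is carried along so that the last link is part of the chain; when a card
  -- is peeled off, it becomes the next `D`.
  sequence-chain : ∀ j {β} (cs : CardsInto j β) D → β ≡ arrival D → Chain (sequence j cs ∷ʳ D)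
  sequence-chain zero    tt           D eq Fin.zero Fin.zero ()
  sequence-chain (suc j) (C , C→ , cs) D eq = Chain-∷ʳ (sequence j cs) C D (sequence-chain j cs C refl) (trans C→ eq)

  sequence-injective : ∀ j {β} (cs cs′ : CardsInto j β) → sequence j cs ≡ sequence j cs′ → cs ≡ cs′
  sequence-injective zero    tt             tt               eq = refl
  sequence-injective (suc j) (C , refl , cs) (C′ , C′→ , cs′) eq with Vecₚ.∷ʳ-injective (sequence j cs) (sequence j cs′) eq
  sequence-injective (suc j) (C , refl , cs) (C , refl , cs′) eq | eq′ , refl = cong (λ cs → C , refl , cs) (sequence-injective j cs cs′ eq′)

  sequence-surjective : ∀ j Cs D → Chain (Cs ∷ʳ D) → Σ (CardsInto j (arrival D)) (λ cs → sequence j cs ≡ Cs)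
  sequence-surjective zero    [] D chain = tt , refl
  sequence-surjective (suc j) Cs D chain with initLast Cs
  ... | Cs′ , C , refl with sequence-surjective j Cs′ C (Chain-∷ʳ⁻ (Cs′ ∷ʳ C) chain)
  ... | cs , refl = (C , Chain-last Cs′ C D chain , cs) , refl

  -- The composition `β` is the departure of the last card, which exists because there are `suc j`
  -- cards. The bound on the length comes from `∑lists` and holds for every composition of `b`, as
  -- parts are positive.
  Histories : ℕ → Set
  Histories j = Σ (List ℕ) (λ β → Parts k β × length β < suc b × (sum β ≡ b × CardsInto (suc j) β))

  cardSeq : ∀ j → Histories j → CardSeq b k (suc j)
  cardSeq j (_ , _ , _ , _ , C , _ , cs) = record { cards = sequence j cs ∷ʳ C ; chain = sequence-chain j cs C refl }

  cardSeq-injective : ∀ j {x y} → cardSeq j x ≡ cardSeq j y → x ≡ y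
  cardSeq-injective j {_ , p , l , s , C , refl , cs} {_ , p′ , l′ , s′ , C′ , refl , cs′} eq
    with Vecₚ.∷ʳ-injective (sequence j cs) (sequence j cs′) (cong cards eq)
  ... | eq′ , refl with sequence-injective j cs cs′ eq′
                      | All.irrelevant (λ { (u , v) (u′ , v′) → cong₂ _,_ (ℕₚ.≤-irrelevant u u′) (ℕₚ.≤-irrelevant v v′) }) p p′
                      | ℕₚ.≤-irrelevant l l′ | ℕₚ.≡-irrelevant s s′
  ... | refl | refl | refl | refl = refl

  departure-parts : (C : Card b k) → Parts k (departure C)
  departure-parts record { departure = β ; departure-pos = pos ; departure-cap = cap } =
    All.zip (recompute (All.all? (1 ℕ.≤?_) β) pos , recompute (All.all? (ℕ._≤? k) β) cap)

  departure-sum : (C : Card b k) → sum (departure C) ≡ b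
  departure-sum record { departure = β ; departure-size = size } = recompute (sum β ℕ.≟ b) size

  cardSeq-surjective : ∀ j y → Σ (Histories j) (λ x → cardSeq j x ≡ y)
  cardSeq-surjective j record { cards = Cs ; chain = chain } with initLast Cs
  ... | Cs′ , C , refl with sequence-surjective j Cs′ C
                              (λ i i′ eq → recompute (Listₚ.≡-dec ℕ._≟_ (departure (lookup Cs i)) (arrival (lookup Cs i′))) (chain i i′ eq))
  ... | cs , refl = (departure C , parts , s≤s (ℕₚ.≤-trans (length≤sum parts) (ℕₚ.≤-reflexive (departure-sum C))) , departure-sum C , C , refl , cs) , refl
    where
    parts : Parts k (departure C)
    parts = departure-parts C
    length≤sum : ∀ {β} → Parts k β → length β ≤ sum β
    length≤sum []              = z≤n
    length≤sum ((1≤p , _) ∷ ps) = ℕₚ.+-mono-≤ 1≤p (length≤sum ps)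

  counted-CardSeq : ∀ j → Counted (∑lists k (suc b) (λ β → if does (sum β ℕ.≟ b) then J k (suc j) β else 0ℤ)) (CardSeq b k (suc j))
  counted-CardSeq j = counted-↔ (bijective⇒↔ (cardSeq j) (cardSeq-injective j) (cardSeq-surjective j))
    (counted-∑lists k (suc b) (λ β parts → counted-if (sum β ℕ.≟ b) ℕₚ.≡-irrelevant (λ sized →
      counted-J (suc j) (record { positive = All.map proj₁ parts ; capped = All.map proj₂ parts ; size = sized }))))

theorem4p5 : (k ℓ : ℕ) → 1 ≤ k → 1 ≤ ℓ →
    (G : Series (suc ℓ)) → IsInverseOf2-Hk k ℓ G →
    (b : ℕ) → Σ ℕ (λ n → (Fin n ↔ CardSeq b k ℓ) × (+ n ≡ RHScoeff k ℓ G b))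
theorem4p5 k (suc ℓ) _ _ G inverse b = counted-≡ (sym (RHScoeff-J k (suc ℓ) b G inverse)) (counted-CardSeq b k ℓ)
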